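{- Let $n \geq 0$ be an integer. Let $A(n)$ be the total number of parts, counted with multiplicity, in all partitions of $n$ all of whose parts are congruent to $\pm 1 \pmod 5$, and let $B(n)$ be the total number of parts in all super-distinct partitions of $n$. Then $A(n) - B(n)$ equals the number of pairs $(\lambda, (a^b))$ of partitions such that $a \geq 1$ and $b \geq 1$ are integers, $\lambda$ is a super-distinct partition of $n - ab$, $a \equiv \pm 1 \pmod 5$, and, if $a = 1$, then at least one of $b-1$, $b$, $b+1$ is a part of $\lambda$.
   Context: A partition of $n$ is a non-increasing sequence of positive integers (parts) summing to $n$; the empty partition is the unique partition of $0$. A partition is super-distinct if any two of its parts differ by at least $2$; the empty partition is considered super-distinct. For positive integers $a,b$, $(a^b)$ denotes the partition consisting of $b$ parts equal to $a$, so the pair $(\lambda,(a^b))$ has total size $|\lambda|+ab$. Pairs are counted as ordered pairs of partitions, i.e. distinct pairs $(\lambda,(a^b))$ are counted separately. -}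

module Defs where

open import Data.Nat using (ℕ; zero; suc; _+_; _*_; _∸_; _≤_; _<_; _≟_; _≤?_; _<?_; _%_)
open import Data.Nat.ListAction using (sum)
open import Data.List using (List; []; _∷_; length; filter; map; concatMap; upTo)
open import Data.List.Relation.Unary.All using (All)
open import Data.List.Relation.Unary.All using (all?)
open import Data.List.Relation.Unary.Any using (Any; any?)
open import Data.List.Relation.Unary.Linked using (Linked)
open import Data.List.Relation.Unary.Linked.Properties using ()
open import Data.Product using (_×_; _,_; proj₁; proj₂)
open import Data.Sum using (_⊎_)
open import Data.Unit using (⊤)
open import Relation.Binary.PropositionalEquality using (_≡_)
open import Relation.Nullary using (Dec; yes; no; ¬_)
open import Relation.Nullary.Decidable using (_×-dec_; _⊎-dec_; _→-dec_; ¬?)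
import Data.List.Relation.Unary.Linked as Lk

IsPartitionOf : ℕ → List ℕ → Set
IsPartitionOf n λs = All (λ p → 1 ≤ p) λs × Linked (λ x y → y ≤ x) λs × sum λs ≡ n

SuperDistinct : List ℕ → Set
SuperDistinct λs = Linked (λ x y → y + 2 ≤ x) λs

PM1mod5 : ℕ → Set
PM1mod5 a = (a % 5 ≡ 1) ⊎ (a % 5 ≡ 4)

isPartitionOf? : ∀ n λs → Dec (IsPartitionOf n λs)
isPartitionOf? n λs =
  all? (λ p → 1 ≤? p) λs ×-dec (Lk.linked? (λ x y → y ≤? x) λs ×-dec (sum λs ≟ n))

superDistinct? : ∀ λs → Dec (SuperDistinct λs)
superDistinct? = Lk.linked? (λ x y → (y + 2) ≤? x)

pm1mod5? : ∀ a → Dec (PM1mod5 a)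
pm1mod5? a = (a % 5 ≟ 1) ⊎-dec (a % 5 ≟ 4)

range1 : ℕ → List ℕ
range1 n = map suc (upTo n)

listsOfLen : ℕ → ℕ → List (List ℕ)
listsOfLen m zero = [] ∷ []
listsOfLen m (suc k) = concatMap (λ x → map (x ∷_) (listsOfLen m k)) (range1 m)

-- all lists of length ≤ n with entries in [1 .. n]; every partition of n is among them
candidates : ℕ → List (List ℕ)
candidates n = concatMap (listsOfLen n) (upTo (suc n))

partitions : ℕ → List (List ℕ)
partitions n = filter (isPartitionOf? n) (candidates n)

A : ℕ → ℕ
A n = sum (map length (filter (λ λs → all? pm1mod5? λs) (partitions n)))

B : ℕ → ℕ
B n = sum (map length (filter superDistinct? (partitions n)))

PairCond : ℕ → ℕ → List ℕ → Set
PairCond a b λs = PM1mod5 a × (a ≡ 1 → Any (λ p → p ≡ b ∸ 1 ⊎ (p ≡ b ⊎ p ≡ suc b)) λs)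

pairCond? : ∀ a b λs → Dec (PairCond a b λs)
pairCond? a b λs = pm1mod5? a ×-dec ((a ≟ 1) →-dec
  any? (λ p → (p ≟ b ∸ 1) ⊎-dec ((p ≟ b) ⊎-dec (p ≟ suc b))) λs)

-- All triples (a, b, λ) with a, b ≥ 1, a*b ≤ n, λ a super-distinct partition of n - ab
-- satisfying PairCond; the pair (λ, (a^b)) is determined by (a, b, λ) and vice versa.
Triple : Set
Triple = ℕ × ℕ × List ℕ

pairs : ℕ → List Triple
pairs n = concatMap (λ a → concatMap (λ b →
    filter (λ t → pairCond? (proj₁ t) (proj₁ (proj₂ t)) (proj₂ (proj₂ t)))
      (map (λ λs → (a , b , λs))
        (filter superDistinct? (partitions (n ∸ a * b)))))
    (filter (λ b → (a * b) ≤? n) (range1 n)))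
  (range1 n)

C : ℕ → ℕ
C n = length (pairs n)

{-# OPTIONS --safe #-}

-- Removing one copy of a part a from the partitions that contain it gives a recursion in n
-- for the total multiplicity of a. Iterated over the partitions into parts ±1 mod 5, it yields
-- A(n) = Σ_{a ≡ ±1} Σ_{b ≥ 1} #{partitions of n − ab into parts ±1 mod 5}, and by the first
-- Rogers–Ramanujan identity the summand is the number of super-distinct partitions of n − ab.
-- These are the pairs counted by C(n), except for the pairs with a = 1 in which none of
-- b − 1, b, b + 1 is a part of λ; adding the part b to λ turns those into the super-distinct
-- partitions of n with a marked part b, which B(n) counts.
--
-- The Rogers–Ramanujan identity is proved in a ring with xᴸ = 0, where all sums and products
-- are finite. As in Hardy and Wright §19.14, the series of super-distinct partitions with parts > k
-- and an alternating theta-like sum S₂ k satisfy the same recursion in k, up to the factor (x; x)∞;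
-- S₂ 0 is then a product by Jacobi's triple product.
module Submission where

open import Defs
open import Algebra.Bundles using (CommutativeRing)
import Algebra.Properties.CommutativeSemiring.Exp
import Algebra.Properties.Ring
import Algebra.Solver.Ring
open import Algebra.Solver.Ring.AlmostCommutativeRing
  using (fromCommutativeRing; _-Raw-AlmostCommutative⟶_)
open import Data.Integer as ℤ using (ℤ; 0ℤ; 1ℤ) renaming (_+_ to _+ℤ_; _*_ to _*ℤ_; -_ to -ℤ_)
import Data.Integer.Properties as ℤ
open import Data.Integer.Tactic.RingSolver using (solve-∀)
open import Data.Maybe using (Maybe; just; nothing)
open import Data.Nat using (ℕ; zero; suc; _≤_; _<_; z≤n; s≤s) renaming (_+_ to _+ₙ_; _*_ to _*ₙ_; _∸_ to _∸ₙ_)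
import Data.Nat.Properties as ℕ
open import Data.Product using (∃; _,_)
open import Data.Sum using (inj₁; inj₂)
import Function
open import Function using (_∘_; _⟨_⟩_)
open import Level using (Level; 0ℓ)
open import Relation.Binary.PropositionalEquality as ≡ using (_≡_; _≗_)
open import Relation.Nullary using (yes; no)

-- The first Rogers-Ramanujan identity in a ring with a nilpotent x.

module RogersRamanujan {ℓ₁ ℓ₂ : Level} (R : CommutativeRing ℓ₁ ℓ₂)
  (fromℤ : CommutativeRing.rawRing ℤ.+-*-commutativeRing -Raw-AlmostCommutative⟶ fromCommutativeRing R)
  where

  open CommutativeRing R hiding (zero)
  open Algebra.Properties.CommutativeSemiring.Exp commutativeSemiring
    using (_^_; ^-homo-*; ^-congʳ; ^-assocʳ; ^-distrib-*)
  open Algebra.Properties.Ring ring using (-0#≈0#; x∙y⁻¹≈ε⇒x≈y)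
  open import Relation.Binary.Reasoning.Setoid setoid
  open _-Raw-AlmostCommutative⟶_ fromℤ using (⟦_⟧)

  private
    ⟦⟧-≟ : ∀ i j → Maybe (⟦ i ⟧ ≈ ⟦ j ⟧)
    ⟦⟧-≟ i j with i ℤ.≟ j
    ... | yes i≡j = just (reflexive (≡.cong ⟦_⟧ i≡j))
    ... | no _    = nothing

  open Algebra.Solver.Ring _ (fromCommutativeRing R) fromℤ ⟦⟧-≟
    using (solve; _:=_; _:+_; _:*_; _:^_; :-_; _:-_)

  Σ : (ℕ → Carrier) → ℕ → Carrier
  Σ f zero    = 0#
  Σ f (suc n) = f 0 + Σ (f ∘ suc) n

  Σ-cong : ∀ {f g} → (∀ i → f i ≈ g i) → ∀ n → Σ f n ≈ Σ g n
  Σ-cong f≈g zero    = refl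
  Σ-cong f≈g (suc n) = +-cong (f≈g 0) (Σ-cong (f≈g ∘ suc) n)

  Σ-+ : ∀ f g n → Σ (λ i → f i + g i) n ≈ Σ f n + Σ g n
  Σ-+ f g zero    = sym (+-identityˡ 0#)
  Σ-+ f g (suc n) = trans (+-congˡ (Σ-+ (f ∘ suc) (g ∘ suc) n))
    (solve 4 (λ a b s t → (a :+ b) :+ (s :+ t) := (a :+ s) :+ (b :+ t)) refl _ _ _ _)

  Σ-*ˡ : ∀ y f n → Σ (λ i → y * f i) n ≈ y * Σ f n
  Σ-*ˡ y f zero    = sym (zeroʳ y)
  Σ-*ˡ y f (suc n) = trans (+-congˡ (Σ-*ˡ y (f ∘ suc) n)) (sym (distribˡ y _ _))

  Σ-zero : ∀ {f} → (∀ i → f i ≈ 0#) → ∀ n → Σ f n ≈ 0#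
  Σ-zero f≈0 zero    = refl
  Σ-zero f≈0 (suc n) = trans (+-cong (f≈0 0) (Σ-zero (f≈0 ∘ suc) n)) (+-identityˡ 0#)

  Σ-+ₙ : ∀ f m n → Σ f (m +ₙ n) ≈ Σ f m + Σ (f ∘ (m +ₙ_)) n
  Σ-+ₙ f zero    n = sym (+-identityˡ _)
  Σ-+ₙ f (suc m) n = trans (+-congˡ (Σ-+ₙ (f ∘ suc) m n)) (sym (+-assoc _ _ _))

  Σ-truncate : ∀ f m n → (∀ i → f (m +ₙ i) ≈ 0#) → Σ f (m +ₙ n) ≈ Σ f m
  Σ-truncate f m n f≈0 =
    trans (Σ-+ₙ f m n) (trans (+-congˡ (Σ-zero f≈0 n)) (+-identityʳ _))

  Σ-sucʳ : ∀ f n → Σ f (suc n) ≈ Σ f n + f n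
  Σ-sucʳ f zero    = trans (+-identityʳ _) (sym (+-identityˡ _))
  Σ-sucʳ f (suc n) = trans (+-congˡ (Σ-sucʳ (f ∘ suc) n)) (sym (+-assoc _ _ _))

  Σ-shift : ∀ f n → f 0 ≈ 0# → f n ≈ 0# → Σ f n ≈ Σ (f ∘ suc) n
  Σ-shift f n f0≈0 fn≈0 = begin
    Σ f n                ≈⟨ +-identityʳ _ ⟨
    Σ f n + 0#           ≈⟨ +-congˡ fn≈0 ⟨
    Σ f n + f n          ≈⟨ Σ-sucʳ f n ⟨
    f 0 + Σ (f ∘ suc) n  ≈⟨ +-congʳ f0≈0 ⟩
    0# + Σ (f ∘ suc) n   ≈⟨ +-identityˡ _ ⟩
    Σ (f ∘ suc) n        ∎

  -- The regrouping behind all the recursions proved by telescoping below: each term is cut in two,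
  -- and the second half is joined with the first half of the next term. The first halves at both
  -- ends are 0.
  Σ-telescope : ∀ (t a b t′ : ℕ → Carrier) n →
    (∀ i → t i ≈ a i + b i) → a 0 ≈ 0# → a n ≈ 0# →
    (∀ i → a (suc i) + b i ≈ t′ i) → Σ t n ≈ Σ t′ n
  Σ-telescope t a b t′ n t≈a+b a0≈0 an≈0 a+b≈t′ = begin
    Σ t n                          ≈⟨ Σ-cong t≈a+b n ⟩
    Σ (λ i → a i + b i) n          ≈⟨ Σ-+ a b n ⟩
    Σ a n + Σ b n                  ≈⟨ +-congʳ (Σ-shift a n a0≈0 an≈0) ⟩
    Σ (a ∘ suc) n + Σ b n          ≈⟨ Σ-+ (a ∘ suc) b n ⟨
    Σ (λ i → a (suc i) + b i) n    ≈⟨ Σ-cong a+b≈t′ n ⟩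
    Σ t′ n                         ∎

  -- Nilpotent elements and q-Pochhammer symbols.

  0*≈0 : ∀ {y z} → y ≈ 0# → y * z ≈ 0#
  0*≈0 y≈0 = trans (*-congʳ y≈0) (zeroˡ _)

  *0≈0 : ∀ {y z} → z ≈ 0# → y * z ≈ 0#
  *0≈0 z≈0 = trans (*-congˡ z≈0) (zeroʳ _)

  1-0≈1 : ∀ {y} → y ≈ 0# → 1# - y ≈ 1#
  1-0≈1 {y} y≈0 = begin
    1# - y   ≈⟨ +-congˡ (-‿cong y≈0) ⟩
    1# - 0#  ≈⟨ +-congˡ -0#≈0# ⟩
    1# + 0#  ≈⟨ +-identityʳ 1# ⟩
    1#       ∎

  ^-nilpotent : ∀ y {m n} → m ≤ n → y ^ m ≈ 0# → y ^ n ≈ 0#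
  ^-nilpotent y {m} {n} m≤n y^m≈0 = begin
    y ^ n                   ≈⟨ ^-congʳ y (≡.sym (ℕ.m+[n∸m]≡n m≤n)) ⟩
    y ^ (m +ₙ (n ∸ₙ m))     ≈⟨ ^-homo-* y m (n ∸ₙ m) ⟩
    y ^ m * y ^ (n ∸ₙ m)    ≈⟨ 0*≈0 y^m≈0 ⟩
    0#                      ∎

  -- (a; q)ₙ
  poch : Carrier → Carrier → ℕ → Carrier
  poch q a zero    = 1#
  poch q a (suc n) = poch q a n * (1# - a * q ^ n)

  poch-cong : ∀ q {a b} → a ≈ b → ∀ n → poch q a n ≈ poch q b n
  poch-cong q a≈b zero    = refl
  poch-cong q a≈b (suc n) =
    *-cong (poch-cong q a≈b n) (+-congˡ (-‿cong (*-congʳ a≈b)))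

  poch-sucˡ : ∀ q a n → (1# - a) * poch q (q * a) n ≈ poch q a (suc n)
  -- `a :^ 0` is the solver's way to write `1#`; a constant would be read as `⟦ 1ℤ ⟧`, which equals
  -- `1#` only up to `_≈_`.
  poch-sucˡ q a zero = solve 1 (λ a → (a :^ 0 :- a) :* a :^ 0 := a :^ 0 :* (a :^ 0 :- a :* a :^ 0)) refl a
  poch-sucˡ q a (suc n) = begin
    (1# - a) * (poch q (q * a) n * (1# - q * a * q ^ n))  ≈⟨ *-assoc _ _ _ ⟨
    (1# - a) * poch q (q * a) n * (1# - q * a * q ^ n)    ≈⟨ *-cong (poch-sucˡ q a n) (+-congˡ (-‿cong
      (solve 3 (λ q a p → q :* a :* p := a :* (q :* p)) refl q a (q ^ n)))) ⟩
    poch q a (suc n) * (1# - a * (q * q ^ n))             ∎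

  poch-zero : ∀ q {a} → a ≈ 0# → ∀ n → poch q a n ≈ 1#
  poch-zero q a≈0 zero    = refl
  poch-zero q a≈0 (suc n) =
    trans (*-cong (poch-zero q a≈0 n) (1-0≈1 (0*≈0 a≈0))) (*-identityˡ 1#)

  -- All factors from index m on are 1, so `poch q a m` plays the role of the infinite product (a;
  -- q)∞.
  poch-truncate : ∀ q a {m} → q ^ m ≈ 0# → ∀ {n} → m ≤ n → poch q a n ≈ poch q a m
  poch-truncate q a {m} q^m≈0 {n} m≤n =
    trans (reflexive (≡.cong (poch q a) (≡.sym (ℕ.m∸n+n≡m m≤n)))) (go (n ∸ₙ m))
    where
    go : ∀ i → poch q a (i +ₙ m) ≈ poch q a m
    go zero    = refl
    go (suc i) = trans (*-cong (go i) (1-0≈1 (*0≈0 (^-nilpotent q (ℕ.m≤n+m m i) q^m≈0)))) (*-identityʳ _)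

  -- Jacobi's triple product.

  module _ (N : ℕ) where

    L : ℕ
    L = suc N

    -- With z = u and q/z = v the triple product (z; q)∞ (q/z; q)∞ (q; q)∞ needs no inverse of z.
    module Jacobi (q u v : Carrier) (uv≈q : u * v ≈ q)
      (u^L≈0 : u ^ L ≈ 0#) (v^L≈0 : v ^ L ≈ 0#) (q^L≈0 : q ^ L ≈ 0#) where

      -- This is (q; q)∞ / (q; q)ᵢ: a factor (q; q)∞ clears the denominators of Euler's series.
      E : ℕ → Carrier
      E i = poch q (q ^ suc i) L

      E-step : ∀ i → (1# - q * q ^ i) * E (suc i) ≈ E i
      E-step i = begin
        (1# - q * q ^ i) * E (suc i)      ≈⟨ poch-sucˡ q (q * q ^ i) L ⟩
        poch q (q ^ suc i) (suc L)        ≈⟨ poch-truncate q _ q^L≈0 (ℕ.n≤1+n L) ⟩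
        E i                               ∎

      E-large : ∀ {i} → L ≤ i → E i ≈ 1#
      E-large L≤i = poch-zero q (^-nilpotent q (ℕ.m≤n⇒m≤1+n L≤i) q^L≈0) L

      -- This is (-1)ʲ wʲ q^{j(j-1)/2}.
      T : Carrier → ℕ → Carrier
      T w zero    = 1#
      T w (suc j) = - (w * q ^ j * T w j)

      T-cong : ∀ {w z} → w ≈ z → ∀ j → T w j ≈ T z j
      T-cong w≈z zero    = refl
      T-cong w≈z (suc j) = -‿cong (*-cong (*-congʳ w≈z) (T-cong w≈z j))

      T-divisible : ∀ w j → ∃ λ y → T w j ≈ w ^ j * y
      T-divisible w zero    = 1# , sym (*-identityˡ 1#)
      T-divisible w (suc j) with T-divisible w j
      ... | y , eq = - (q ^ j * y) , trans (-‿cong (*-congˡ eq))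
        (solve 4 (λ w p W y → :- (w :* p :* (W :* y)) := w :* W :* :- (p :* y)) refl w (q ^ j) (w ^ j) y)

      T-large : ∀ w → w ^ L ≈ 0# → ∀ {j} → L ≤ j → T w j ≈ 0#
      T-large w w^L≈0 {j} L≤j with T-divisible w j
      ... | y , eq = trans eq (0*≈0 (^-nilpotent w L≤j w^L≈0))

      T-q : ∀ w j → T (q * w) j ≈ q ^ j * T w j
      T-q w zero    = sym (*-identityˡ 1#)
      T-q w (suc j) = trans (-‿cong (*-congˡ (T-q w j)))
        (solve 4 (λ q w p t → :- (q :* w :* p :* (p :* t)) := q :* p :* :- (w :* p :* t)) refl q w (q ^ j) (T w j))

      -- Euler's series for (w; q)∞, multiplied by (q; q)∞.
      Y : Carrier → Carrier
      Y w = Σ (λ j → T w j * E j) L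

      Y-cong : ∀ {w z} → w ≈ z → Y w ≈ Y z
      Y-cong w≈z = Σ-cong (λ j → *-congʳ {x = E j} (T-cong w≈z j)) L

      -- Write `E j` as (1 - qʲ) `E j` + qʲ `E j`. By `E-step`, the first half of term j + 1 is -w
      -- times the second half of term j.
      Y-step : ∀ w → w ^ L ≈ 0# → Y w ≈ (1# - w) * Y (q * w)
      Y-step w w^L≈0 = trans
        (Σ-telescope _ (λ j → T w j * ((1# - q ^ j) * E j)) (λ j → q ^ j * T w j * E j)
          (λ j → (1# - w) * (T (q * w) j * E j)) L
          (λ j → solve 3 (λ t p e → t :* e := t :* ((t :^ 0 :- p) :* e) :+ p :* t :* e) refl (T w j) (q ^ j) (E j))
          (solve 2 (λ t e → t :* ((t :^ 0 :- t :^ 0) :* e) := t :- t) refl (T w 0) (E 0) ⟨ trans ⟩ -‿inverseʳ _)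
          (0*≈0 (T-large w w^L≈0 ℕ.≤-refl))
          (λ j → begin
            - (w * q ^ j * T w j) * ((1# - q * q ^ j) * E (suc j)) + q ^ j * T w j * E j
              ≈⟨ +-congʳ (*-congˡ (E-step j)) ⟩
            - (w * q ^ j * T w j) * E j + q ^ j * T w j * E j
              ≈⟨ solve 4 (λ w p t e → :- (w :* p :* t) :* e :+ p :* t :* e := (t :^ 0 :- w) :* (p :* t :* e)) refl w (q ^ j) (T w j) (E j) ⟩
            (1# - w) * (q ^ j * T w j * E j)
              ≈⟨ *-congˡ (*-congʳ (T-q w j)) ⟨
            (1# - w) * (T (q * w) j * E j) ∎))
        (Σ-*ˡ _ (λ j → T (q * w) j * E j) L)

      Y-zero : ∀ {w} → w ≈ 0# → Y w ≈ E 0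
      Y-zero {w} w≈0 = trans (+-cong (*-identityˡ _)
        (Σ-zero (λ j → 0*≈0 (trans (-‿cong (0*≈0 (0*≈0 w≈0))) -0#≈0#)) N))
        (+-identityʳ _)

      Y-iterate : ∀ n → Y u ≈ poch q u n * Y (q ^ n * u)
      Y-iterate zero    = trans (Y-cong (sym (*-identityˡ u))) (sym (*-identityˡ _))
      Y-iterate (suc n) = begin
        Y u                                                   ≈⟨ Y-iterate n ⟩
        poch q u n * Y (q ^ n * u)                            ≈⟨ *-congˡ (Y-step (q ^ n * u) (trans (^-distrib-* (q ^ n) u L) (*0≈0 u^L≈0))) ⟩
        poch q u n * ((1# - q ^ n * u) * Y (q * (q ^ n * u))) ≈⟨ *-assoc _ _ _ ⟨
        poch q u n * (1# - q ^ n * u) * Y (q * (q ^ n * u))   ≈⟨ *-cong (*-congˡ (+-congˡ (-‿cong (*-comm _ _)))) (Y-cong (sym (*-assoc _ _ _))) ⟩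
        poch q u (suc n) * Y (q ^ suc n * u)                  ∎

      -- Each `Y-step` takes out one factor of (u; q)∞ and multiplies the argument by q. After L
      -- steps the argument is 0 and only the term `E 0` remains.
      euler : Y u ≈ poch q u L * poch q q L
      euler = trans (Y-iterate L) (*-congˡ (trans (Y-zero (0*≈0 q^L≈0)) (poch-cong q (*-identityʳ q) L)))

      -- g n i is the coefficient T_{i−n} of the bilateral theta series, so that passing
      -- from n to n + 1 extends the sum by one negative index.
      g : ℕ → ℕ → Carrier
      g zero    i       = T u i
      g (suc n) zero    = - (v * q ^ n * g n 0)
      g (suc n) (suc i) = g n i

      -- Formally T_{k+1} = -u qᵏ T_k, also for negative k. With k = i - n the powers of q combine
      -- to qⁱ, and uv = q supplies the last factor, so that no negative power appears.
      g-step : ∀ n i → - (v * q ^ n * g n (suc i)) ≈ q * q ^ i * g n i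
      g-step zero i = trans
        (solve 5 (λ o v u p t → :- (v :* o :* :- (u :* p :* t)) := u :* v :* o :* p :* t) refl 1# v u (q ^ i) (T u i))
        (*-congʳ (*-congʳ (trans (*-identityʳ _) uv≈q)))
      g-step (suc n) zero =
        solve 4 (λ v q p t → :- (v :* (q :* p) :* t) := q :* q :^ 0 :* :- (v :* p :* t)) refl v q (q ^ n) (g n 0)
      g-step (suc n) (suc i) = begin
        - (v * (q * q ^ n) * g n (suc i))   ≈⟨ solve 4 (λ v q p t → :- (v :* (q :* p) :* t) := q :* :- (v :* p :* t)) refl v q (q ^ n) (g n (suc i)) ⟩
        q * - (v * q ^ n * g n (suc i))     ≈⟨ *-congˡ (g-step n i) ⟩
        q * (q * q ^ i * g n i)             ≈⟨ *-assoc _ _ _ ⟨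
        q * (q * q ^ i) * g n i             ∎

      g-right : ∀ n i → L +ₙ n ≤ i → g n i ≈ 0#
      g-right zero    i L≤i = T-large u u^L≈0 (≡.subst (_≤ i) (ℕ.+-identityʳ L) L≤i)
      g-right (suc n) (suc i) (s≤s L+n≤i) = g-right n i (≡.subst (_≤ i) (ℕ.+-suc N n) L+n≤i)

      g-left-divisible : ∀ n → ∃ λ y → g n 0 ≈ v ^ n * y
      g-left-divisible zero    = 1# , sym (*-identityˡ 1#)
      g-left-divisible (suc n) with g-left-divisible n
      ... | y , eq = - (q ^ n * y) , trans (-‿cong (*-congˡ eq))
        (solve 4 (λ w p W y → :- (w :* p :* (W :* y)) := w :* W :* :- (p :* y)) refl v (q ^ n) (v ^ n) y)

      g-left : ∀ n i → i +ₙ L ≤ n → g n i ≈ 0#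
      g-left n zero L≤n with g-left-divisible n
      ... | y , eq = trans eq (0*≈0 (^-nilpotent v L≤n v^L≈0))
      g-left (suc n) (suc i) (s≤s i+L≤n) = g-left n i i+L≤n

      G : ℕ → Carrier
      G n = Σ (λ i → g n i * E i) (n +ₙ L)

      -- By `E-step` and `g-step`, term i of `G n` and -v qⁿ times its term i + 1 add up to term i +
      -- 1 of `G (suc n)`. What is left, -v qⁿ times term 0, is the new term 0.
      G-step : ∀ n → G (suc n) ≈ (1# - v * q ^ n) * G n
      G-step n = sym (begin
        (1# - V) * G n
          ≈⟨ solve 2 (λ V s → (V :^ 0 :- V) :* s := s :+ :- V :* s) refl V (G n) ⟩
        G n + - V * G n
          ≈⟨ +-congˡ (sym (Σ-*ˡ (- V) (λ i → g n i * E i) (n +ₙ L))) ⟩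
        G n + Σ h (n +ₙ L)
          -- The sum may be extended by the term of index n + L, which is 0 by `g-right`; this makes
          -- room for the shift of the index.
          ≈⟨ +-congˡ (sym (trans (Σ-sucʳ h (n +ₙ L)) (trans (+-congˡ (*0≈0 (0*≈0 (g-right n _ (ℕ.≤-reflexive (ℕ.+-comm L n)))))) (+-identityʳ _)))) ⟩
        G n + (h 0 + Σ (h ∘ suc) (n +ₙ L))
          ≈⟨ solve 3 (λ a b c → a :+ (b :+ c) := b :+ (a :+ c)) refl _ _ _ ⟩
        h 0 + (G n + Σ (h ∘ suc) (n +ₙ L))
          ≈⟨ +-cong (solve 3 (λ V t e → :- V :* (t :* e) := :- (V :* t) :* e) refl V (g n 0) (E 0)) (trans (sym (Σ-+ _ _ (n +ₙ L))) (Σ-cong step (n +ₙ L))) ⟩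
        G (suc n) ∎)
        where
        V : Carrier
        V = v * q ^ n
        h : ℕ → Carrier
        h i = - V * (g n i * E i)
        step : ∀ i → g n i * E i + - V * (g n (suc i) * E (suc i)) ≈ g n i * E (suc i)
        step i = begin
          g n i * E i + - V * (g n (suc i) * E (suc i))
            ≈⟨ +-cong (*-congˡ (sym (E-step i))) (solve 3 (λ V t e → :- V :* (t :* e) := :- (V :* t) :* e) refl V (g n (suc i)) (E (suc i))) ⟩
          g n i * ((1# - q * q ^ i) * E (suc i)) + - (V * g n (suc i)) * E (suc i)
            ≈⟨ +-congˡ (*-congʳ (g-step n i)) ⟩
          g n i * ((1# - q * q ^ i) * E (suc i)) + q * q ^ i * g n i * E (suc i)
            ≈⟨ solve 3 (λ t p e → t :* ((t :^ 0 :- p) :* e) :+ p :* t :* e := t :* e) refl (g n i) (q * q ^ i) (E (suc i)) ⟩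
          g n i * E (suc i) ∎

      G-product : ∀ n → G n ≈ poch q v n * (poch q u L * poch q q L)
      G-product zero    = trans euler (sym (*-identityˡ _))
      G-product (suc n) = trans (G-step n) (trans (*-congˡ (G-product n))
        (solve 3 (λ a b c → a :* (b :* c) := b :* a :* c) refl _ _ _))

      g-sum : ∀ n → Σ (g n) (n +ₙ L) ≈ Σ (T u) L + Σ (λ j → g (suc j) 0) n
      g-sum zero    = sym (+-identityʳ _)
      g-sum (suc n) = trans (+-congˡ (g-sum n))
        (trans (solve 3 (λ a b c → a :+ (b :+ c) := b :+ (c :+ a)) refl _ _ _) (+-congˡ (sym (Σ-sucʳ (λ j → g (suc j) 0) n))))

      triple-product : poch q v L * (poch q u L * poch q q L) ≈ Σ (T u) L + Σ (λ j → g (suc j) 0) L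
      triple-product = begin
        poch q v L * (poch q u L * poch q q L)                ≈⟨ *-congʳ (poch-truncate q v q^L≈0 (ℕ.m≤m+n L L)) ⟨
        poch q v (L +ₙ L) * (poch q u L * poch q q L)         ≈⟨ G-product (L +ₙ L) ⟨
        G (L +ₙ L)                                            ≈⟨ Σ-cong no-E (L +ₙ L +ₙ L) ⟩
        Σ (g (L +ₙ L)) (L +ₙ L +ₙ L)                          ≈⟨ g-sum (L +ₙ L) ⟩
        Σ (T u) L + Σ (λ j → g (suc j) 0) (L +ₙ L)            ≈⟨ +-congˡ (Σ-truncate (λ j → g (suc j) 0) L L λ i → g-left _ 0 (ℕ.m≤n⇒m≤1+n (ℕ.m≤m+n L i))) ⟩
        Σ (T u) L + Σ (λ j → g (suc j) 0) L                   ∎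
        where
        no-E : ∀ i → g (L +ₙ L) i * E i ≈ g (L +ₙ L) i
        no-E i with ℕ.≤-total L i
        ... | inj₁ L≤i = trans (*-congˡ (E-large L≤i)) (*-identityʳ _)
        ... | inj₂ i≤L = trans (0*≈0 g≈0) (sym g≈0)
          where
          g≈0 : g (L +ₙ L) i ≈ 0#
          g≈0 = g-left (L +ₙ L) i (ℕ.+-monoˡ-≤ L i≤L)

    -- The alternating sums of Hardy and Wright and their recursion.

    module _ (x : Carrier) (x^L≈0 : x ^ L ≈ 0#) where

      ^-^-comm : ∀ m n → (x ^ m) ^ n ≈ (x ^ n) ^ m
      ^-^-comm m n = trans (^-assocʳ x m n) (trans (^-congʳ x (ℕ.*-comm m n)) (sym (^-assocʳ x n m)))

      ^suc-nilpotent : ∀ n → (x ^ suc n) ^ L ≈ 0#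
      ^suc-nilpotent n = trans (^-^-comm (suc n) L) (0*≈0 x^L≈0)

      1^ : ∀ n → (1# * 1#) ^ n ≈ 1#
      1^ zero    = refl
      1^ (suc n) = trans (*-cong (*-identityˡ 1#) (1^ n)) (*-identityˡ 1#)

      -- c r = (−1)ʳ x^{r(5r+1)/2} and m k r = x^{2kr}
      c : ℕ → Carrier
      c zero    = 1#
      c (suc r) = - (c r * (x ^ 3 * (x ^ r) ^ 5))

      m : ℕ → ℕ → Carrier
      m k r = (x ^ k * x ^ k) ^ r

      -- This is (x; x)_{r+k} / (x; x)ᵣ: the denominators in the sums of Hardy and Wright after
      -- multiplication by (x; x)∞.
      W : ℕ → ℕ → Carrier
      W r k = poch x (x * x ^ r) k

      -- Their sums over r are (x; x)∞ times H₁(a) and H₂(a) of Hardy and Wright, at a = x^{k+1}.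
      S₁-term S₂-term : ℕ → ℕ → Carrier
      S₁-term k r = c r * m k r * x ^ r * (1# - x * x ^ k * (x ^ r * x ^ r)) * W r k
      S₂-term k r = c r * m k r * (1# - (x * x ^ k * (x ^ r * x ^ r)) ^ 2) * W r k

      S₁ S₂ : ℕ → Carrier
      S₁ k = Σ (S₁-term k) L
      S₂ k = Σ (S₂-term k) L

      c-divisible : ∀ r → ∃ λ y → c r ≈ x ^ r * y
      c-divisible zero    = 1# , sym (*-identityˡ 1#)
      c-divisible (suc r) with c-divisible r
      ... | y , eq = - (y * (x ^ 2 * (x ^ r) ^ 5)) , trans (-‿cong (*-congʳ eq))
        (solve 3 (λ x X y → :- (X :* y :* (x :^ 3 :* X :^ 5)) := x :* X :* :- (y :* (x :^ 2 :* X :^ 5))) refl x (x ^ r) y)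

      c-L : c L ≈ 0#
      c-L with c-divisible L
      ... | y , eq = trans eq (0*≈0 x^L≈0)

      m-suc : ∀ k r → m (suc k) r ≈ m k r * (x ^ r * x ^ r)
      m-suc k zero    = sym (trans (*-identityˡ _) (*-identityˡ _))
      m-suc k (suc r) = trans (*-congˡ (m-suc k r))
        (solve 4 (λ x K X M → x :* K :* (x :* K) :* (M :* (X :* X)) := K :* K :* M :* (x :* X :* (x :* X))) refl x (x ^ k) (x ^ r) (m k r))

      W-suc : ∀ r k → (1# - x * x ^ r) * W (suc r) k ≈ W r (suc k)
      W-suc r k = poch-sucˡ x (x * x ^ r) k

      -- Split 1 - x^{k+1+2r} into (1 - xʳ) + xʳ (1 - x^{r+k+1}). The second factor extends `W r k`
      -- to `W r (suc k)`; by `W-suc` the first one, taken at r + 1, also produces `W r (suc k)`.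
      S₁≈S₂ : ∀ k → S₁ k ≈ S₂ (suc k)
      S₁≈S₂ k = Σ-telescope _
        (λ r → c r * m k r * x ^ r * ((1# - x ^ r) * W r k))
        (λ r → c r * m k r * x ^ r * x ^ r * W r (suc k)) _ L
        (λ r → solve 6 (λ x K X C M W →
            C :* M :* X :* (x :^ 0 :- x :* K :* (X :* X)) :* W
              := C :* M :* X :* ((x :^ 0 :- X) :* W) :+ C :* M :* X :* X :* (W :* (x :^ 0 :- x :* X :* K)))
            refl x (x ^ k) (x ^ r) (c r) (m k r) (W r k))
        (*0≈0 (0*≈0 (-‿inverseʳ 1#)))
        (0*≈0 (0*≈0 (0*≈0 c-L)))
        (λ r → begin
          c (suc r) * m k (suc r) * x ^ suc r * ((1# - x * x ^ r) * W (suc r) k) + c r * m k r * x ^ r * x ^ r * W r (suc k)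
            ≈⟨ +-congʳ (*-congˡ (W-suc r k)) ⟩
          c (suc r) * m k (suc r) * x ^ suc r * W r (suc k) + c r * m k r * x ^ r * x ^ r * W r (suc k)
            ≈⟨ solve 6 (λ x K X C M W →
                :- (C :* (x :^ 3 :* X :^ 5)) :* (K :* K :* M) :* (x :* X) :* W :+ C :* M :* X :* X :* W
                  := C :* (M :* (X :* X)) :* (x :^ 0 :- (x :* (x :* K) :* (X :* X)) :^ 2) :* W)
                refl x (x ^ k) (x ^ r) (c r) (m k r) (W r (suc k)) ⟩
          c r * (m k r * (x ^ r * x ^ r)) * (1# - (x * (x * x ^ k) * (x ^ r * x ^ r)) ^ 2) * W r (suc k)
            ≈⟨ *-congʳ (*-congʳ (*-congˡ (m-suc k r))) ⟨
          S₂-term (suc k) r ∎)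

      -- Split 1 - x^{2k+2+4r} into (1 - xʳ) + xʳ (1 - x^{k+1+2r}) + x^{k+1+3r} (1 - x^{r+k+1}). The
      -- middle part gives `S₁ k`; the outer two, joined across consecutive r, give x^{k+1} times
      -- `S₁ (suc k)`. Then `S₁≈S₂` applies to both.
      S₂-step : ∀ k → S₂ k ≈ S₂ (suc k) + x ^ suc k * S₂ (suc (suc k))
      S₂-step k = begin
        S₂ k
          ≈⟨ Σ-telescope _
               (λ r → c r * m k r * ((1# - x ^ r) * W r k))
               (λ r → S₁-term k r + x * x ^ k * (x ^ r) ^ 3 * c r * m k r * W r (suc k)) _ L
               (λ r → solve 6 (λ x K X C M W →
                   C :* M :* (x :^ 0 :- (x :* K :* (X :* X)) :^ 2) :* W
                     := C :* M :* ((x :^ 0 :- X) :* W) :+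
                        (C :* M :* X :* (x :^ 0 :- x :* K :* (X :* X)) :* W :+
                         x :* K :* X :^ 3 :* C :* M :* (W :* (x :^ 0 :- x :* X :* K))))
                   refl x (x ^ k) (x ^ r) (c r) (m k r) (W r k))
               (*0≈0 (0*≈0 (-‿inverseʳ 1#)))
               (0*≈0 (0*≈0 c-L))
               step ⟩
        Σ (λ r → S₁-term k r + x ^ suc k * S₁-term (suc k) r) L
          ≈⟨ Σ-+ (S₁-term k) (λ r → x ^ suc k * S₁-term (suc k) r) L ⟩
        S₁ k + Σ (λ r → x ^ suc k * S₁-term (suc k) r) L
          ≈⟨ +-congˡ (Σ-*ˡ (x ^ suc k) (S₁-term (suc k)) L) ⟩
        S₁ k + x ^ suc k * S₁ (suc k)
          ≈⟨ +-cong (S₁≈S₂ k) (*-congˡ (S₁≈S₂ (suc k))) ⟩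
        S₂ (suc k) + x ^ suc k * S₂ (suc (suc k)) ∎
        where
        step : ∀ r → c (suc r) * m k (suc r) * ((1# - x ^ suc r) * W (suc r) k)
                       + (S₁-term k r + x * x ^ k * (x ^ r) ^ 3 * c r * m k r * W r (suc k))
                     ≈ S₁-term k r + x ^ suc k * S₁-term (suc k) r
        step r = begin
          c (suc r) * m k (suc r) * ((1# - x * x ^ r) * W (suc r) k) + (S₁-term k r + x * x ^ k * (x ^ r) ^ 3 * c r * m k r * W r (suc k))
            ≈⟨ +-congʳ (*-congˡ (W-suc r k)) ⟩
          c (suc r) * m k (suc r) * W r (suc k) + (S₁-term k r + x * x ^ k * (x ^ r) ^ 3 * c r * m k r * W r (suc k))
            ≈⟨ solve 7 (λ x K X C M W s →
                :- (C :* (x :^ 3 :* X :^ 5)) :* (K :* K :* M) :* W :+ (s :+ x :* K :* X :^ 3 :* C :* M :* W)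
                  := s :+ x :* K :* (C :* (M :* (X :* X)) :* X :* (x :^ 0 :- x :* (x :* K) :* (X :* X)) :* W))
                refl x (x ^ k) (x ^ r) (c r) (m k r) (W r (suc k)) (S₁-term k r) ⟩
          S₁-term k r + x * x ^ k * (c r * (m k r * (x ^ r * x ^ r)) * x ^ r * (1# - x * (x * x ^ k) * (x ^ r * x ^ r)) * W r (suc k))
            ≈⟨ +-congˡ (*-congˡ (*-congʳ (*-congʳ (*-congʳ (*-congˡ (m-suc k r)))))) ⟨
          S₁-term k r + x ^ suc k * S₁-term (suc k) r ∎

      -- Here xᵏ = 0, which leaves only the term r = 0.
      S₂-large : ∀ k → L ≤ k → S₂ k ≈ poch x x L
      S₂-large k L≤k = begin
        S₂-term k 0 + Σ (S₂-term k ∘ suc) N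
          ≈⟨ +-cong (*-congʳ (*-cong (*-identityˡ 1#) (1-0≈1 (0*≈0 (0*≈0 (*0≈0 x^k≈0))))))
               (Σ-zero (λ r → 0*≈0 (0*≈0 (*0≈0 (0*≈0 (0*≈0 x^k≈0))))) N) ⟩
        1# * 1# * W 0 k + 0#   ≈⟨ trans (+-identityʳ _) (trans (*-congʳ (*-identityˡ 1#)) (*-identityˡ _)) ⟩
        W 0 k                  ≈⟨ poch-truncate x _ x^L≈0 L≤k ⟩
        W 0 L                  ≈⟨ poch-cong x (*-identityʳ x) L ⟩
        poch x x L             ∎
        where
        x^k≈0 : x ^ k ≈ 0#
        x^k≈0 = ^-nilpotent x L≤k x^L≈0

      theta : S₂ 0 ≈ poch (x ^ 5) (x ^ 2) L * (poch (x ^ 5) (x ^ 3) L * poch (x ^ 5) (x ^ 5) L)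
      theta = sym (begin
        poch (x ^ 5) (x ^ 2) L * (poch (x ^ 5) (x ^ 3) L * poch (x ^ 5) (x ^ 5) L)  ≈⟨ J.triple-product ⟩
        Σ (J.T (x ^ 3)) L + Σ (λ j → J.g (suc j) 0) L                       ≈⟨ Σ-+ (J.T (x ^ 3)) (λ j → J.g (suc j) 0) L ⟨
        Σ (λ j → J.T (x ^ 3) j + J.g (suc j) 0) L                           ≈⟨ Σ-cong (λ j → trans (+-cong (T≈c j) (g≈c j)) (term j)) L ⟩
        S₂ 0                                                                ∎)
        where
        module J = Jacobi (x ^ 5) (x ^ 3) (x ^ 2) (sym (^-homo-* x 3 2))
          (^suc-nilpotent 2) (^suc-nilpotent 1) (^suc-nilpotent 4)
        T≈c : ∀ r → J.T (x ^ 3) r ≈ c r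
        T≈c zero    = refl
        T≈c (suc r) = -‿cong (trans (*-cong (*-congˡ (^-^-comm 5 r)) (T≈c r)) (*-comm _ _))
        g≈c : ∀ r → J.g (suc r) 0 ≈ - (c r * (x ^ 2 * (x ^ r) ^ 4))
        g≈c zero    = solve 1 (λ x → :- (x :^ 2 :* x :^ 0 :* x :^ 0) := :- (x :^ 0 :* (x :^ 2 :* (x :^ 0) :^ 4))) refl x
        g≈c (suc r) = trans (-‿cong (*-cong (*-congˡ (*-congˡ (^-^-comm 5 r))) (g≈c r)))
          (solve 3 (λ x X C → :- (x :^ 2 :* (x :^ 5 :* X :^ 5) :* :- (C :* (x :^ 2 :* X :^ 4)))
              := :- (:- (C :* (x :^ 3 :* X :^ 5)) :* (x :^ 2 :* (x :* X) :^ 4))) refl x (x ^ r) (c r))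
        term : ∀ r → c r + - (c r * (x ^ 2 * (x ^ r) ^ 4)) ≈ S₂-term 0 r
        term r = trans
          (solve 3 (λ x X C → C :+ :- (C :* (x :^ 2 :* X :^ 4))
              := C :* x :^ 0 :* (x :^ 0 :- (x :* x :^ 0 :* (X :* X)) :^ 2) :* x :^ 0) refl x (x ^ r) (c r))
          (*-congʳ (*-congʳ (*-congˡ (sym (1^ r)))))

      -- Cancellation and comparison with the product.

      cancel : ∀ y {z} n → y ^ n ≈ 0# → (1# - y) * z ≈ 0# → z ≈ 0#
      -- The equation says z = yz, hence z = yⁿz = 0.
      cancel y {z} n y^n≈0 eq = trans (go n) (0*≈0 y^n≈0)
        where
        z≈yz : z ≈ y * z
        z≈yz = begin
          z                        ≈⟨ solve 2 (λ y z → z := (y :^ 0 :- y) :* z :+ y :* z) refl y z ⟩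
          (1# - y) * z + y * z     ≈⟨ +-congʳ eq ⟩
          0# + y * z               ≈⟨ +-identityˡ _ ⟩
          y * z                    ∎
        go : ∀ n → z ≈ y ^ n * z
        go zero    = sym (*-identityˡ z)
        go (suc n) = trans z≈yz (trans (*-congˡ (go n)) (sym (*-assoc _ _ _)))

      poch-cancel : ∀ {z} n → poch x x n * z ≈ 0# → z ≈ 0#
      poch-cancel zero    eq = trans (sym (*-identityˡ _)) eq
      poch-cancel (suc n) eq =
        cancel (x ^ suc n) L (^suc-nilpotent n) (poch-cancel n (trans (sym (*-assoc _ _ _)) eq))

      -- The factors 1 - xⁱ with 1 ≤ i ≤ 5n are sorted by the residue of i modulo 5. Residues 2, 3
      -- and 5 are those in `theta`, so 1 and 4 are left over.
      poch-residues : ∀ n → poch x x (n *ₙ 5) ≈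
        poch (x ^ 5) (x ^ 1) n * poch (x ^ 5) (x ^ 2) n * poch (x ^ 5) (x ^ 3) n * poch (x ^ 5) (x ^ 4) n * poch (x ^ 5) (x ^ 5) n
      poch-residues zero = solve 1 (λ x → x :^ 0 := x :^ 0 :* x :^ 0 :* x :^ 0 :* x :^ 0 :* x :^ 0) refl x
      poch-residues (suc n) = trans
        (*-cong (*-cong (*-cong (*-cong (*-cong (poch-residues n) (factor 0)) (factor 1)) (factor 2)) (factor 3)) (factor 4))
        (solve 10 (λ a b c d e a′ b′ c′ d′ e′ → a :* b :* c :* d :* e :* a′ :* b′ :* c′ :* d′ :* e′
            := (a :* a′) :* (b :* b′) :* (c :* c′) :* (d :* d′) :* (e :* e′)) refl _ _ _ _ _ _ _ _ _ _)
        where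
        factor : ∀ i → 1# - x * x ^ (i +ₙ n *ₙ 5) ≈ 1# - x ^ suc i * (x ^ 5) ^ n
        factor i = +-congˡ (-‿cong (trans (^-homo-* x (suc i) (n *ₙ 5))
          (*-congˡ (trans (^-congʳ x (ℕ.*-comm n 5)) (sym (^-assocʳ x 5 n))))))

      -- F k stands for the series of the super-distinct partitions with all parts > k,
      -- p n for that of the partitions into parts ≤ 5n that are ±1 mod 5.
      rogers-ramanujan : (F p : ℕ → Carrier) →
        (∀ k → L ≤ k → F k ≈ 1#) →
        (∀ k → F k ≈ F (suc k) + x ^ suc k * F (suc (suc k))) →
        p 0 ≈ 1# →
        (∀ n → (1# - x ^ suc (n *ₙ 5)) * ((1# - x ^ (4 +ₙ n *ₙ 5)) * p (suc n)) ≈ p n) →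
        F 0 ≈ p L
      rogers-ramanujan F p F-large F-step p-0 p-step =
        -- It suffices to compare both sides after multiplication by (x; x)_{5L}, which
        -- `poch-cancel` removes.
        x∙y⁻¹≈ε⇒x≈y _ _ (poch-cancel (L *ₙ 5) (begin
          poch x x (L *ₙ 5) * (F 0 - p L)
            ≈⟨ solve 3 (λ a b c → a :* (b :- c) := a :* b :- a :* c) refl _ _ _ ⟩
          poch x x (L *ₙ 5) * F 0 - poch x x (L *ₙ 5) * p L
            ≈⟨ +-cong (trans (*-congʳ (poch-truncate x x x^L≈0 (ℕ.m≤m*n L 5))) (trans (F≈S₂ L 0 (ℕ.m≤m+n L 0)) theta))
                 (-‿cong (*-congʳ (poch-residues L))) ⟩
          Π 2 * (Π 3 * Π 5) - Π 1 * Π 2 * Π 3 * Π 4 * Π 5 * p L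
            ≈⟨ solve 6 (λ a b c d e z → b :* (c :* e) :- a :* b :* c :* d :* e :* z
                 := b :* (c :* e) :- b :* (c :* e) :* (a :* d :* z)) refl (Π 1) (Π 2) (Π 3) (Π 4) (Π 5) (p L) ⟩
          Π 2 * (Π 3 * Π 5) - Π 2 * (Π 3 * Π 5) * (Π 1 * Π 4 * p L)
            ≈⟨ +-congˡ (-‿cong (trans (*-congˡ (p-inverse L)) (*-identityʳ _))) ⟩
          Π 2 * (Π 3 * Π 5) - Π 2 * (Π 3 * Π 5)
            ≈⟨ -‿inverseʳ _ ⟩
          0# ∎))
        where
        Π : ℕ → Carrier
        Π i = poch (x ^ 5) (x ^ i) L
        -- Downward induction on k with the recursion that F and `S₂` share; d bounds the distance
        -- to the range k ≥ L, where F is 1.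
        F≈S₂ : ∀ d k → L ≤ d +ₙ k → poch x x L * F k ≈ S₂ k
        F≈S₂ zero k L≤k = trans (trans (*-congˡ (F-large k L≤k)) (*-identityʳ _)) (sym (S₂-large k L≤k))
        F≈S₂ (suc d) k L≤ = begin
          P * F k
            ≈⟨ *-congˡ (F-step k) ⟩
          P * (F (suc k) + x ^ suc k * F (suc (suc k)))
            ≈⟨ solve 4 (λ P a y b → P :* (a :+ y :* b) := P :* a :+ y :* (P :* b)) refl P (F (suc k)) (x ^ suc k) (F (suc (suc k))) ⟩
          P * F (suc k) + x ^ suc k * (P * F (suc (suc k)))
            ≈⟨ +-cong (F≈S₂ d (suc k) L≤′) (*-congˡ (F≈S₂ d (suc (suc k)) (ℕ.≤-trans L≤′ (ℕ.+-monoʳ-≤ d (ℕ.n≤1+n (suc k)))))) ⟩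
          S₂ (suc k) + x ^ suc k * S₂ (suc (suc k))
            ≈⟨ S₂-step k ⟨
          S₂ k ∎
          where
          P : Carrier
          P = poch x x L
          L≤′ : L ≤ d +ₙ suc k
          L≤′ = ≡.subst (L ≤_) (≡.sym (ℕ.+-suc d k)) L≤
        p-inverse : ∀ n → poch (x ^ 5) (x ^ 1) n * poch (x ^ 5) (x ^ 4) n * p n ≈ 1#
        p-inverse zero    = trans (*-cong (*-identityˡ 1#) p-0) (*-identityˡ 1#)
        p-inverse (suc n) = begin
          P₁ * (1# - x ^ 1 * (x ^ 5) ^ n) * (P₄ * (1# - x ^ 4 * (x ^ 5) ^ n)) * p (suc n)
            ≈⟨ solve 5 (λ P₁ P₄ a b z → P₁ :* a :* (P₄ :* b) :* z := P₁ :* P₄ :* (a :* (b :* z))) refl P₁ P₄ _ _ (p (suc n)) ⟩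
          P₁ * P₄ * ((1# - x ^ 1 * (x ^ 5) ^ n) * ((1# - x ^ 4 * (x ^ 5) ^ n) * p (suc n)))
            ≈⟨ *-congˡ (*-cong (factor 1) (*-congʳ (factor 4))) ⟩
          P₁ * P₄ * ((1# - x ^ suc (n *ₙ 5)) * ((1# - x ^ (4 +ₙ n *ₙ 5)) * p (suc n)))
            ≈⟨ *-congˡ (p-step n) ⟩
          P₁ * P₄ * p n
            ≈⟨ p-inverse n ⟩
          1# ∎
          where
          P₁ P₄ : Carrier
          P₁ = poch (x ^ 5) (x ^ 1) n
          P₄ = poch (x ^ 5) (x ^ 4) n
          factor : ∀ i → 1# - x ^ i * (x ^ 5) ^ n ≈ 1# - x ^ (i +ₙ n *ₙ 5)
          factor i = +-congˡ (-‿cong (sym (trans (^-homo-* x i (n *ₙ 5))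
            (*-congˡ (trans (^-congʳ x (ℕ.*-comm n 5)) (sym (^-assocʳ x 5 n)))))))

-- Power series modulo xᴸ

Series : Set
Series = ℕ → ℤ

infixl 6 _⊕_
infixl 7 _⊛_ _·_

_⊕_ : Series → Series → Series
(f ⊕ g) n = f n +ℤ g n

_·_ : ℤ → Series → Series
(a · f) n = a *ℤ f n

⊖_ : Series → Series
(⊖ f) n = -ℤ f n

const : ℤ → Series
const a zero    = a
const a (suc n) = 0ℤ

_⊛_ : Series → Series → Series
(f ⊛ g) zero    = f 0 *ℤ g 0
(f ⊛ g) (suc n) = f 0 *ℤ g (suc n) +ℤ (f ∘ suc ⊛ g) n

-- Coefficient n of a product involves only the coefficients up to n of its factors; this makes the
-- product well defined modulo xᴸ.
⊛-cong : ∀ {f f′ g g′} n → (∀ i → i ≤ n → f i ≡ f′ i) → (∀ i → i ≤ n → g i ≡ g′ i) →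
  (f ⊛ g) n ≡ (f′ ⊛ g′) n
⊛-cong zero    f≡f′ g≡g′ = ≡.cong₂ _*ℤ_ (f≡f′ 0 z≤n) (g≡g′ 0 z≤n)
⊛-cong (suc n) f≡f′ g≡g′ = ≡.cong₂ _+ℤ_
  (≡.cong₂ _*ℤ_ (f≡f′ 0 z≤n) (g≡g′ (suc n) ℕ.≤-refl))
  (⊛-cong n (λ i i≤n → f≡f′ (suc i) (s≤s i≤n)) (λ i i≤n → g≡g′ i (ℕ.m≤n⇒m≤1+n i≤n)))

⊛-distribʳ : ∀ f g h → (f ⊕ g) ⊛ h ≗ f ⊛ h ⊕ g ⊛ h
⊛-distribʳ f g h zero    = ℤ.*-distribʳ-+ (h 0) (f 0) (g 0)
⊛-distribʳ f g h (suc n) = ≡.trans (≡.cong ((f 0 +ℤ g 0) *ℤ h (suc n) +ℤ_) (⊛-distribʳ (f ∘ suc) (g ∘ suc) h n))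
  (lemma (f 0) (g 0) (h (suc n)) ((f ∘ suc ⊛ h) n) ((g ∘ suc ⊛ h) n))
  where
  lemma : ∀ a b c s t → (a +ℤ b) *ℤ c +ℤ (s +ℤ t) ≡ (a *ℤ c +ℤ s) +ℤ (b *ℤ c +ℤ t)
  lemma = solve-∀

⊛-scalar : ∀ a f g → (a · f) ⊛ g ≗ a · (f ⊛ g)
⊛-scalar a f g zero    = ℤ.*-assoc a (f 0) (g 0)
⊛-scalar a f g (suc n) = ≡.trans (≡.cong (a *ℤ f 0 *ℤ g (suc n) +ℤ_) (⊛-scalar a (f ∘ suc) g n))
  (lemma a (f 0) (g (suc n)) ((f ∘ suc ⊛ g) n))
  where
  lemma : ∀ a b c s → a *ℤ b *ℤ c +ℤ a *ℤ s ≡ a *ℤ (b *ℤ c +ℤ s)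
  lemma = solve-∀

⊛-zeroˡ : ∀ f → (λ _ → 0ℤ) ⊛ f ≗ λ _ → 0ℤ
⊛-zeroˡ f zero    = ≡.refl
⊛-zeroˡ f (suc n) = ≡.trans (ℤ.+-identityˡ _) (⊛-zeroˡ f n)

⊛-const : ∀ a f → const a ⊛ f ≗ a · f
⊛-const a f zero    = ≡.refl
⊛-const a f (suc n) = ≡.trans (≡.cong (a *ℤ f (suc n) +ℤ_) (⊛-zeroˡ f n)) (ℤ.+-identityʳ _)

⊛-identityˡ : ∀ f → const 1ℤ ⊛ f ≗ f
⊛-identityˡ f n = ≡.trans (⊛-const 1ℤ f n) (ℤ.*-identityˡ (f n))

⊛-sucʳ : ∀ f g n → (f ⊛ g) (suc n) ≡ f (suc n) *ℤ g 0 +ℤ (f ⊛ g ∘ suc) n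
⊛-sucʳ f g zero    = ℤ.+-comm (f 0 *ℤ g 1) _
⊛-sucʳ f g (suc n) = ≡.trans (≡.cong (f 0 *ℤ g (suc (suc n)) +ℤ_) (⊛-sucʳ (f ∘ suc) g n))
  (lemma (f 0 *ℤ g (suc (suc n))) (f (suc (suc n)) *ℤ g 0) _)
  where
  lemma : ∀ a b c → a +ℤ (b +ℤ c) ≡ b +ℤ (a +ℤ c)
  lemma = solve-∀

⊛-comm : ∀ f g → f ⊛ g ≗ g ⊛ f
⊛-comm f g zero    = ℤ.*-comm (f 0) (g 0)
⊛-comm f g (suc n) = ≡.trans (≡.cong₂ _+ℤ_ (ℤ.*-comm (f 0) (g (suc n))) (⊛-comm (f ∘ suc) g n))
  (≡.sym (⊛-sucʳ g f n))

⊛-assoc : ∀ f g h → (f ⊛ g) ⊛ h ≗ f ⊛ (g ⊛ h)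
⊛-assoc f g h zero    = ℤ.*-assoc (f 0) (g 0) (h 0)
⊛-assoc f g h (suc n) = begin
  -- By definition, `f ⊛ g` shifted by one is `f 0 · (g ∘ suc) ⊕ (f ∘ suc ⊛ g)`.
  f 0 *ℤ g 0 *ℤ h (suc n) +ℤ ((f 0 · (g ∘ suc) ⊕ (f ∘ suc ⊛ g)) ⊛ h) n
    ≡⟨ ≡.cong (f 0 *ℤ g 0 *ℤ h (suc n) +ℤ_) (⊛-distribʳ (f 0 · (g ∘ suc)) (f ∘ suc ⊛ g) h n) ⟩
  f 0 *ℤ g 0 *ℤ h (suc n) +ℤ ((f 0 · (g ∘ suc) ⊛ h) n +ℤ ((f ∘ suc ⊛ g) ⊛ h) n)
    ≡⟨ ≡.cong (f 0 *ℤ g 0 *ℤ h (suc n) +ℤ_) (≡.cong₂ _+ℤ_ (⊛-scalar (f 0) (g ∘ suc) h n) (⊛-assoc (f ∘ suc) g h n)) ⟩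
  f 0 *ℤ g 0 *ℤ h (suc n) +ℤ (f 0 *ℤ (g ∘ suc ⊛ h) n +ℤ (f ∘ suc ⊛ (g ⊛ h)) n)
    ≡⟨ lemma (f 0) (g 0) (h (suc n)) _ _ ⟩
  f 0 *ℤ (g 0 *ℤ h (suc n) +ℤ (g ∘ suc ⊛ h) n) +ℤ (f ∘ suc ⊛ (g ⊛ h)) n ∎
  where
  open ≡.≡-Reasoning
  lemma : ∀ a b c s t → a *ℤ b *ℤ c +ℤ (a *ℤ s +ℤ t) ≡ a *ℤ (b *ℤ c +ℤ s) +ℤ t
  lemma = solve-∀

module Truncated (L : ℕ) where

  infix 4 _≈ₛ_

  _≈ₛ_ : Series → Series → Set
  f ≈ₛ g = ∀ i → i < L → f i ≡ g i

  ≗⇒≈ₛ : ∀ {f g} → f ≗ g → f ≈ₛ g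
  ≗⇒≈ₛ f≗g i _ = f≗g i

  ring : CommutativeRing 0ℓ 0ℓ
  ring = record
    { Carrier = Series
    ; _≈_ = _≈ₛ_
    ; _+_ = _⊕_
    ; _*_ = _⊛_
    ; -_ = ⊖_
    ; 0# = λ _ → 0ℤ
    ; 1# = const 1ℤ
    ; isCommutativeRing = record
      { isRing = record
        { +-isAbelianGroup = record
          { isGroup = record
            { isMonoid = record
              { isSemigroup = record
                { isMagma = record
                  { isEquivalence = record
                    { refl = λ _ _ → ≡.refl
                    ; sym = λ f≈g i i<L → ≡.sym (f≈g i i<L)
                    ; trans = λ f≈g g≈h i i<L → ≡.trans (f≈g i i<L) (g≈h i i<L)
                    }
                  ; ∙-cong = λ f≈f′ g≈g′ i i<L → ≡.cong₂ _+ℤ_ (f≈f′ i i<L) (g≈g′ i i<L)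
                  }
                ; assoc = λ f g h i _ → ℤ.+-assoc (f i) (g i) (h i)
                }
              ; identity = (λ f i _ → ℤ.+-identityˡ (f i)) , (λ f i _ → ℤ.+-identityʳ (f i))
              }
            ; inverse = (λ f i _ → ℤ.+-inverseˡ (f i)) , (λ f i _ → ℤ.+-inverseʳ (f i))
            ; ⁻¹-cong = λ f≈g i i<L → ≡.cong -ℤ_ (f≈g i i<L)
            }
          ; comm = λ f g i _ → ℤ.+-comm (f i) (g i)
          }
        ; *-cong = λ f≈f′ g≈g′ i i<L → ⊛-cong i
            (λ j j≤i → f≈f′ j (ℕ.≤-<-trans j≤i i<L)) (λ j j≤i → g≈g′ j (ℕ.≤-<-trans j≤i i<L))
        ; *-assoc = λ f g h → ≗⇒≈ₛ (⊛-assoc f g h)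
        ; *-identity = (λ f → ≗⇒≈ₛ (⊛-identityˡ f))
                     , (λ f i _ → ≡.trans (⊛-comm f (const 1ℤ) i) (⊛-identityˡ f i))
        ; distrib = (λ f g h i _ → ≡.trans (⊛-comm f (g ⊕ h) i)
                      (≡.trans (⊛-distribʳ g h f i) (≡.cong₂ _+ℤ_ (⊛-comm g f i) (⊛-comm h f i))))
                  , (λ h f g → ≗⇒≈ₛ (⊛-distribʳ f g h))
        }
      ; *-comm = λ f g → ≗⇒≈ₛ (⊛-comm f g)
      }
    }

  constants : CommutativeRing.rawRing ℤ.+-*-commutativeRing -Raw-AlmostCommutative⟶ fromCommutativeRing ring
  constants = record
    { ⟦_⟧ = const
    ; +-homo = λ { a b zero _ → ≡.refl ; a b (suc i) _ → ≡.refl }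
    ; *-homo = λ { a b zero _ → ≡.refl
                 ; a b (suc i) _ → ≡.sym (≡.trans (⊛-const a (const b) (suc i)) (ℤ.*-zeroʳ a)) }
    ; -‿homo = λ { a zero _ → ≡.refl ; a (suc i) _ → ≡.refl }
    ; 0-homo = λ { zero _ → ≡.refl ; (suc i) _ → ≡.refl }
    ; 1-homo = λ _ _ → ≡.refl
    }

  X : Series
  X zero    = 0ℤ
  X (suc n) = const 1ℤ n

  open import Algebra.Properties.CommutativeSemiring.Exp (CommutativeRing.commutativeSemiring ring) using (_^_)

  shift : ℕ → Series → Series
  shift zero    f n       = f n
  shift (suc k) f zero    = 0ℤ
  shift (suc k) f (suc n) = shift k f n

  X^-⊛ : ∀ k f → X ^ k ⊛ f ≗ shift k f
  X^-⊛ zero    f n = ⊛-identityˡ f n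
  X^-⊛ (suc k) f n = ≡.trans (⊛-assoc X (X ^ k) f n) (go n)
    where
    go : X ⊛ (X ^ k ⊛ f) ≗ shift (suc k) f
    go zero    = ≡.refl
    go (suc n) = ≡.trans (ℤ.+-identityˡ _) (≡.trans (⊛-identityˡ (X ^ k ⊛ f) n) (X^-⊛ k f n))

  shift-< : ∀ k f {n} → n < k → shift k f n ≡ 0ℤ
  shift-< (suc k) f {zero}  _         = ≡.refl
  shift-< (suc k) f {suc n} (s≤s n<k) = shift-< k f n<k

  shift-≤ : ∀ k f {n} → k ≤ n → shift k f n ≡ f (n ∸ₙ k)
  shift-≤ zero    f _         = ≡.refl
  shift-≤ (suc k) f (s≤s k≤n) = shift-≤ k f k≤n

  X^-nilpotent : X ^ L ≈ₛ λ _ → 0ℤ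
  X^-nilpotent i i<L = ≡.trans (≡.sym (≡.trans (⊛-comm (X ^ L) (const 1ℤ) i) (⊛-identityˡ (X ^ L) i)))
    (≡.trans (X^-⊛ L (const 1ℤ) i) (shift-< L _ i<L))

-- Partitions

open import Data.Bool using (true; false; if_then_else_)
open import Data.Nat using (ℕ; zero; suc; _+_; _*_; _∸_; _%_; _≤_; _<_; _≥_; z≤n; s≤s; _≟_; _≤?_; _≤ᵇ_; _<?_; >-nonZero)
open import Data.Nat.DivMod using ([m+kn]%n≡m%n)
open import Data.Nat.ListAction using (sum)
open import Data.Nat.ListAction.Properties using (sum-↭)
open import Data.Nat.Properties
open import Data.List using (List; []; _∷_; _++_; length; filter; map; concatMap; upTo; cartesianProductWith)
open import Data.List.Properties using (length-++; map-∘; length-map; map-upTo; filter-none; filter-all; filter-accept; filter-reject)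
open import Data.List.Membership.Propositional using (_∈_; _∉_; lose)
open import Data.List.Membership.Propositional.Properties
  using (∈-filter⁺; ∈-filter⁻; ∈-map⁺; ∈-map⁻; ∈-concatMap⁺; ∈-upTo⁺; ∈-upTo⁻; ∈-cartesianProductWith⁺; ∈-cartesianProductWith⁻)
open import Data.List.Membership.Propositional.Properties.WithK using (unique∧set⇒bag)
open import Data.List.Membership.DecPropositional _≟_ using (_∈?_)
open import Data.List.Relation.Binary.BagAndSetEquality using (∼bag⇒↭)
open import Data.List.Relation.Binary.Permutation.Propositional using (_↭_; ↭-sym; ↭⇒↭ₛ)
open import Data.List.Relation.Binary.Permutation.Propositional.Properties using (All-resp-↭; ∈-resp-↭; ↭-length; filter-↭)
  renaming (map⁺ to map⁺-↭)
import Data.List.Relation.Binary.Permutation.Setoid.Properties as Permₛ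
open import Data.List.Relation.Unary.All as All using (All; []; _∷_; all?)
import Data.List.Relation.Unary.All.Properties as All
open import Data.List.Relation.Unary.AllPairs as AllPairs using (AllPairs; []; _∷_)
import Data.List.Relation.Unary.AllPairs.Properties as AllPairs
open import Data.List.Relation.Unary.Any as Any using (Any; here; there)
open import Data.List.Relation.Unary.Linked using (Linked)
open import Data.List.Relation.Unary.Linked.Properties using (AllPairs⇒Linked; Linked⇒AllPairs)
open import Data.List.Relation.Unary.Unique.Propositional using (Unique)
import Data.List.Relation.Unary.Unique.Propositional.Properties as Unique
open import Relation.Binary.Construct.Flip.EqAndOrd using (decTotalOrder)
open import Data.List.Sort.InsertionSort.Base (decTotalOrder ≤-decTotalOrder) using (insert)
open import Data.List.Sort.InsertionSort.Properties (decTotalOrder ≤-decTotalOrder) using (insert-↭; insert-↗)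
open import Data.Product using (_×_; _,_; proj₁; proj₂)
open import Data.Sum using (_⊎_; inj₁; inj₂; swap)
open import Function using (_∘_; id; mk⇔; _⇔_; case_of_)
open import Relation.Binary using (tri<; tri≈; tri>)
open import Relation.Binary.PropositionalEquality
open import Relation.Nullary using (Dec; yes; no; does; ¬_; contradiction)
open import Relation.Nullary.Decidable using (_×-dec_; _⊎-dec_; ¬?; dec-true; dec-false; decidable-stable; does-⇔)
open import Relation.Unary using (Pred; Decidable)

private
  variable
    U V : Set
    P Q R : Pred U 0ℓ

-- Sums over lists and lengths of filtered lists.

∑ : List U → (U → ℕ) → ℕ
∑ xs f = sum (map f xs)

∑-cong : ∀ {f g : U → ℕ} xs → (∀ {x} → x ∈ xs → f x ≡ g x) → ∑ xs f ≡ ∑ xs g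
∑-cong []       f≡g = refl
∑-cong (x ∷ xs) f≡g = cong₂ _+_ (f≡g (here refl)) (∑-cong xs (f≡g ∘ there))

∑-zero : ∀ {f : U → ℕ} xs → (∀ {x} → x ∈ xs → f x ≡ 0) → ∑ xs f ≡ 0
∑-zero []       f≡0 = refl
∑-zero (x ∷ xs) f≡0 = cong₂ _+_ (f≡0 (here refl)) (∑-zero xs (f≡0 ∘ there))

∑-+ : ∀ (f g : U → ℕ) xs → ∑ xs (λ x → f x + g x) ≡ ∑ xs f + ∑ xs g
∑-+ f g []       = refl
∑-+ f g (x ∷ xs) = trans (cong (f x + g x +_) (∑-+ f g xs)) (interchange (f x) (g x) _ _)
  where open import Algebra.Properties.CommutativeSemigroup +-commutativeSemigroup using (interchange)

∑-swap : ∀ (f : U → V → ℕ) xs ys → ∑ xs (λ x → ∑ ys (f x)) ≡ ∑ ys (λ y → ∑ xs (λ x → f x y))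
∑-swap f []       ys = sym (∑-zero ys (λ _ → refl))
∑-swap f (x ∷ xs) ys = trans (cong (∑ ys (f x) +_) (∑-swap f xs ys)) (sym (∑-+ (f x) _ ys))

∑-map : ∀ (f : V → ℕ) (g : U → V) xs → ∑ (map g xs) f ≡ ∑ xs (f ∘ g)
∑-map f g xs = cong sum (sym (map-∘ xs))

∑-suc : ∀ (f : U → ℕ) xs → ∑ xs (suc ∘ f) ≡ length xs + ∑ xs f
∑-suc f []       = refl
∑-suc f (x ∷ xs) = cong suc (trans (cong (f x +_) (∑-suc f xs)) (x∙yz≈y∙xz (f x) (length xs) _))
  where open import Algebra.Properties.CommutativeSemigroup +-commutativeSemigroup using (x∙yz≈y∙xz)

∑-filter : ∀ (P? : Decidable P) (f : U → ℕ) xs →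
  ∑ (filter P? xs) f ≡ ∑ xs (λ x → if does (P? x) then f x else 0)
∑-filter P? f []       = refl
∑-filter P? f (x ∷ xs) with does (P? x)
... | true  = cong (f x +_) (∑-filter P? f xs)
... | false = ∑-filter P? f xs

∑-support : ∀ (P? : Decidable P) (f : U → ℕ) xs → (∀ x → ¬ P x → f x ≡ 0) →
  ∑ xs f ≡ ∑ (filter P? xs) f
∑-support P? f []       f≡0 = refl
∑-support P? f (x ∷ xs) f≡0 with P? x
... | yes _ = cong (f x +_) (∑-support P? f xs f≡0)
... | no ¬p = cong₂ _+_ (f≡0 x ¬p) (∑-support P? f xs f≡0)

length-concatMap : ∀ (f : U → List V) xs → length (concatMap f xs) ≡ ∑ xs (length ∘ f)
length-concatMap f []       = refl
length-concatMap f (x ∷ xs) = trans (length-++ (f x)) (cong (length (f x) +_) (length-concatMap f xs))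

length-filter-cong : ∀ (P? : Decidable P) (Q? : Decidable Q) (xs : List U) →
  (∀ {x} → x ∈ xs → P x ⇔ Q x) → length (filter P? xs) ≡ length (filter Q? xs)
length-filter-cong P? Q? []       P⇔Q = refl
length-filter-cong P? Q? (x ∷ xs) P⇔Q with P? x | Q? x
... | yes _ | yes _ = cong suc (length-filter-cong P? Q? xs (P⇔Q ∘ there))
... | no  _ | no  _ = length-filter-cong P? Q? xs (P⇔Q ∘ there)
... | yes p | no ¬q = contradiction (to (P⇔Q (here refl)) p) ¬q where open Function.Equivalence
... | no ¬p | yes q = contradiction (from (P⇔Q (here refl)) q) ¬p where open Function.Equivalence

length-filter-split : ∀ (P? : Decidable P) (Q? : Decidable Q) (xs : List U) →
  (∀ {x} → x ∈ xs → P x → ¬ Q x) → (∀ {x} → x ∈ xs → ¬ P x → Q x) →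
  length xs ≡ length (filter P? xs) + length (filter Q? xs)
length-filter-split P? Q? []       P⇒¬Q ¬P⇒Q = refl
length-filter-split P? Q? (x ∷ xs) P⇒¬Q ¬P⇒Q with P? x | Q? x
... | yes p | yes q = contradiction q (P⇒¬Q (here refl) p)
... | yes _ | no  _ = cong suc (length-filter-split P? Q? xs (P⇒¬Q ∘ there) (¬P⇒Q ∘ there))
... | no  _ | yes _ = trans (cong suc (length-filter-split P? Q? xs (P⇒¬Q ∘ there) (¬P⇒Q ∘ there))) (sym (+-suc _ _))
... | no ¬p | no ¬q = contradiction (¬P⇒Q (here refl) ¬p) ¬q

filter-filter : ∀ (P? : Decidable P) (Q? : Decidable Q) (xs : List U) →
  filter P? (filter Q? xs) ≡ filter (λ x → Q? x ×-dec P? x) xs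
filter-filter P? Q? []       = refl
filter-filter P? Q? (x ∷ xs) with does (Q? x)
... | false = filter-filter P? Q? xs
... | true with does (P? x)
...   | true  = cong (x ∷_) (filter-filter P? Q? xs)
...   | false = filter-filter P? Q? xs

length-filter-map : ∀ (P? : Decidable P) (f : U → V) xs →
  length (filter P? (map f xs)) ≡ length (filter (P? ∘ f) xs)
length-filter-map P? f []       = refl
length-filter-map P? f (x ∷ xs) with does (P? (f x))
... | true  = cong suc (length-filter-map P? f xs)
... | false = length-filter-map P? f xs

-- Bijections are used in this form: two enumerations without repetitions and with the same members
-- give equal lengths and sums.
unique-↭ : ∀ {xs ys : List U} → Unique xs → Unique ys → (∀ {x} → x ∈ xs ⇔ x ∈ ys) → xs ↭ ys
unique-↭ u v eq = ∼bag⇒↭ (unique∧set⇒bag u v eq)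

-- The enumeration of partitions is complete and has no repetitions.

∈-range1⁺ : ∀ {a n} → 1 ≤ a → a ≤ n → a ∈ range1 n
∈-range1⁺ {suc a} _ a<n = ∈-map⁺ suc (∈-upTo⁺ a<n)

∈-range1⁻ : ∀ {a n} → a ∈ range1 n → 1 ≤ a × a ≤ n
∈-range1⁻ a∈ with ∈-map⁻ suc a∈
... | b , b∈ , refl = s≤s z≤n , ∈-upTo⁻ b∈

range1-unique : ∀ n → Unique (range1 n)
range1-unique n = Unique.map⁺ suc-injective (Unique.upTo⁺ n)

range1-suc : ∀ n → range1 (suc n) ≡ 1 ∷ map suc (range1 n)
range1-suc n = cong (λ xs → 1 ∷ map suc xs) (sym (map-upTo suc n))

listsOfLen-suc : ∀ m k → listsOfLen m (suc k) ≡ cartesianProductWith _∷_ (range1 m) (listsOfLen m k)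
listsOfLen-suc m k = go (range1 m)
  where
  go : ∀ xs → concatMap (λ x → map (x ∷_) (listsOfLen m k)) xs ≡ cartesianProductWith _∷_ xs (listsOfLen m k)
  go []       = refl
  go (x ∷ xs) = cong (map (x ∷_) (listsOfLen m k) ++_) (go xs)

listsOfLen-unique : ∀ m k → Unique (listsOfLen m k)
listsOfLen-unique m zero    = [] ∷ []
listsOfLen-unique m (suc k) rewrite listsOfLen-suc m k =
  Unique.cartesianProductWith⁺ _∷_ (λ { refl → refl , refl }) (range1-unique m) (listsOfLen-unique m k)

∈-listsOfLen⁺ : ∀ {m xs} → All (_∈ range1 m) xs → xs ∈ listsOfLen m (length xs)
∈-listsOfLen⁺ []         = here refl
∈-listsOfLen⁺ {m} {_ ∷ xs} (x∈ ∷ xs∈) rewrite listsOfLen-suc m (length xs) =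
  ∈-cartesianProductWith⁺ _∷_ x∈ (∈-listsOfLen⁺ xs∈)

∈-listsOfLen⁻ : ∀ m k {xs} → xs ∈ listsOfLen m k → length xs ≡ k
∈-listsOfLen⁻ m zero    (here refl) = refl
∈-listsOfLen⁻ m (suc k) xs∈ rewrite listsOfLen-suc m k
  with ∈-cartesianProductWith⁻ _∷_ (range1 m) (listsOfLen m k) xs∈
... | _ , _ , _ , ys∈ , refl = cong suc (∈-listsOfLen⁻ m k ys∈)

-- Blocks with different indices are disjoint because their lists have different lengths.
candidates-unique : ∀ n → Unique (candidates n)
candidates-unique n = Unique.concat⁺ {xss = map (listsOfLen n) (upTo (suc n))}
  (All.map⁺ {xs = upTo (suc n)} (All.universal (listsOfLen-unique n) (upTo (suc n))))
  (AllPairs.map⁺ (AllPairs.map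
    (λ {i} {j} i≢j {_} (xs∈ , xs∈′) → i≢j (trans (sym (∈-listsOfLen⁻ n i xs∈)) (∈-listsOfLen⁻ n j xs∈′)))
    (Unique.upTo⁺ (suc n))))

partitions-unique : ∀ n → Unique (partitions n)
partitions-unique n = Unique.filter⁺ (isPartitionOf? n) (candidates-unique n)

∈⇒≤sum : ∀ {a xs} → a ∈ xs → a ≤ sum xs
∈⇒≤sum {xs = x ∷ xs} (here refl) = m≤m+n x (sum xs)
∈⇒≤sum {xs = x ∷ xs} (there a∈)  = ≤-trans (∈⇒≤sum a∈) (m≤n+m (sum xs) x)

length≤sum : ∀ {xs} → All (1 ≤_) xs → length xs ≤ sum xs
length≤sum []         = z≤n
length≤sum (1≤x ∷ ps) = +-mono-≤ 1≤x (length≤sum ps)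

∈-partitions⁻ : ∀ {n λs} → λs ∈ partitions n → IsPartitionOf n λs
∈-partitions⁻ {n} λs∈ = proj₂ (∈-filter⁻ (isPartitionOf? n) {xs = candidates n} λs∈)

∈-partitions⇒∈-range1 : ∀ {n λs} → λs ∈ partitions n → All (_∈ range1 n) λs
∈-partitions⇒∈-range1 {n} {λs} λs∈ with ∈-partitions⁻ {n} λs∈
... | pos , _ , refl = All.tabulate (λ x∈ → ∈-range1⁺ (All.lookup pos x∈) (∈⇒≤sum x∈))

-- The length and every part of a partition of n are at most n, so the partition is among the
-- candidates.
∈-partitions⁺ : ∀ {n λs} → IsPartitionOf n λs → λs ∈ partitions n
∈-partitions⁺ {n} {λs} p@(pos , _ , refl) = ∈-filter⁺ (isPartitionOf? n)
  (∈-concatMap⁺ (listsOfLen n) (lose (∈-upTo⁺ (s≤s (length≤sum pos)))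
    (∈-listsOfLen⁺ (All.tabulate (λ x∈ → ∈-range1⁺ (All.lookup pos x∈) (∈⇒≤sum x∈)))))) p

-- Inserting and removing a part; multiplicities.

Descending : List ℕ → Set
Descending = Linked (λ x y → y ≤ x)

-- The comparison is the one made by `insert`, so `remove-insert` holds for every list. In a
-- descending list that contains a, the dropped entry is a copy of a.
remove : ℕ → List ℕ → List ℕ
remove a []       = []
remove a (y ∷ ys) = if does (y ≤? a) then ys else y ∷ remove a ys

remove-insert : ∀ a μ → remove a (insert a μ) ≡ μ
remove-insert a [] rewrite dec-true (a ≤? a) ≤-refl = refl
remove-insert a (y ∷ ys) with y ≤? a
... | yes y≤a rewrite dec-true (y ≤? a) y≤a | dec-true (a ≤? a) ≤-refl = refl
... | no y≰a rewrite dec-false (y ≤? a) y≰a | dec-false (y ≤? a) y≰a = cong (y ∷_) (remove-insert a ys)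

insert-injective : ∀ a {μ ν} → insert a μ ≡ insert a ν → μ ≡ ν
insert-injective a {μ} {ν} eq = trans (sym (remove-insert a μ)) (trans (cong (remove a) eq) (remove-insert a ν))

≥-trans : ∀ {x y z} → y ≤ x → z ≤ y → z ≤ x
≥-trans y≤x z≤y = ≤-trans z≤y y≤x

insert-smaller : ∀ a {ys} → All (_≤ a) ys → insert a ys ≡ a ∷ ys
insert-smaller a []              = refl
insert-smaller a {y ∷ _} (y≤a ∷ _) rewrite dec-true (y ≤? a) y≤a = refl

insert-remove : ∀ a {λs} → AllPairs _≥_ λs → a ∈ λs → insert a (remove a λs) ≡ λs
insert-remove a {y ∷ ys} (y≥ ∷ ys↘) a∈ with y ≤? a
... | yes y≤a rewrite dec-true (y ≤? a) y≤a = trans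
  (insert-smaller a (All.map (λ z≤y → ≤-trans z≤y y≤a) y≥))
  (cong (_∷ ys) (≤-antisym (All.lookup (≤-refl ∷ y≥) a∈) y≤a))
... | no y≰a rewrite dec-false (y ≤? a) y≰a | dec-false (y ≤? a) y≰a = cong (y ∷_)
  (insert-remove a ys↘ (Any.tail (λ a≡y → y≰a (≤-reflexive (sym a≡y))) a∈))

All-remove : ∀ a {λs} → All P λs → All P (remove a λs)
All-remove a []                  = []
All-remove a {y ∷ _} (p ∷ ps) with y ≤ᵇ a
... | true  = ps
... | false = p ∷ All-remove a ps

AllPairs-remove : ∀ a {λs} → AllPairs _≥_ λs → AllPairs _≥_ (remove a λs)
AllPairs-remove a []                  = []
AllPairs-remove a {y ∷ _} (p ∷ ps) with y ≤ᵇ a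
... | true  = ps
... | false = All-remove a p ∷ AllPairs-remove a ps

sum-insert : ∀ a μ → sum (insert a μ) ≡ a + sum μ
sum-insert a μ = sum-↭ (insert-↭ a μ)

All-insert⁺ : ∀ {a μ} → P a → All P μ → All P (insert a μ)
All-insert⁺ {a = a} {μ} p ps = All-resp-↭ (↭-sym (insert-↭ a μ)) (p ∷ ps)

All-insert⁻ : ∀ a μ → All P (insert a μ) → P a × All P μ
All-insert⁻ a μ ps with All-resp-↭ (insert-↭ a μ) ps
... | p ∷ ps′ = p , ps′

∈-insert : ∀ a μ → a ∈ insert a μ
∈-insert a μ = ∈-resp-↭ (↭-sym (insert-↭ a μ)) (here refl)

count : ℕ → List ℕ → ℕ
count a λs = length (filter (a ≟_) λs)

count-insert : ∀ a μ → count a (insert a μ) ≡ suc (count a μ)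
count-insert a μ = trans (↭-length (filter-↭ (a ≟_) (insert-↭ a μ))) (cong length (filter-accept (a ≟_) refl))

count-∉ : ∀ a {λs} → a ∉ λs → count a λs ≡ 0
count-∉ a {λs} a∉ = cong length (filter-none (a ≟_) (All.¬Any⇒All¬ λs a∉))

-- Each entry y contributes 1 to the term a = y alone, and y occurs exactly once in `range1 n`.
∑-count : ∀ {n λs} → All (_∈ range1 n) λs → ∑ (range1 n) (λ a → count a λs) ≡ length λs
∑-count {n} []                   = ∑-zero (range1 n) (λ _ → refl)
∑-count {n} {y ∷ ys} (y∈ ∷ ys∈) = begin
  ∑ (range1 n) (λ a → count a (y ∷ ys))                                       ≡⟨ ∑-cong (range1 n) (λ {a} _ → step a) ⟩
  ∑ (range1 n) (λ a → (if does (y ≟ a) then 1 else 0) + count a ys)           ≡⟨ ∑-+ _ _ (range1 n) ⟩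
  ∑ (range1 n) (λ a → (if does (y ≟ a) then 1 else 0)) + ∑ (range1 n) (λ a → count a ys)
    ≡⟨ cong₂ _+_ (sym (∑-filter (y ≟_) (λ _ → 1) (range1 n))) (∑-count ys∈) ⟩
  ∑ (filter (y ≟_) (range1 n)) (λ _ → 1) + length ys
    ≡⟨ cong (_+ length ys) (sum-↭ (map⁺-↭ _ (unique-↭ (Unique.filter⁺ (y ≟_) (range1-unique n)) ([] ∷ []) (mk⇔ to from)))) ⟩
  suc (length ys) ∎
  where
  open ≡-Reasoning
  step : ∀ a → count a (y ∷ ys) ≡ (if does (y ≟ a) then 1 else 0) + count a ys
  step a with a ≟ y
  ... | yes a≡y rewrite dec-true (y ≟ a) (sym a≡y) = cong length (filter-accept (a ≟_) a≡y)
  ... | no  a≢y rewrite dec-false (y ≟ a) (a≢y ∘ sym) = cong length (filter-reject (a ≟_) a≢y)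
  to : ∀ {x} → x ∈ filter (y ≟_) (range1 n) → x ∈ y ∷ []
  to x∈ = here (sym (proj₂ (∈-filter⁻ (y ≟_) {xs = range1 n} x∈)))
  from : ∀ {x} → x ∈ y ∷ [] → x ∈ filter (y ≟_) (range1 n)
  from (here refl) = ∈-filter⁺ (y ≟_) y∈ refl

-- Removing one copy of a part.

# : {P : Pred (List ℕ) 0ℓ} → Decidable P → ℕ → ℕ
# P? n = length (filter P? (partitions n))

module Marking {P Q : Pred (List ℕ) 0ℓ} (P? : Decidable P) (Q? : Decidable Q) (a : ℕ) (1≤a : 1 ≤ a)
  (P⇔Q : ∀ {μ} → Descending μ → P (insert a μ) ⇔ Q μ) where

  open Function.Equivalence

  -- `insert a` and `remove a` are inverse to each other between the partitions of n that contain a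
  -- and all partitions of n - a; `P⇔Q` matches the two properties.
  marked-↭ : ∀ {n} → a ≤ n →
    filter (a ∈?_) (filter P? (partitions n)) ↭ map (insert a) (filter Q? (partitions (n ∸ a)))
  marked-↭ {n} a≤n = unique-↭
    (Unique.filter⁺ (a ∈?_) (Unique.filter⁺ P? (partitions-unique n)))
    (Unique.map⁺ (insert-injective a) (Unique.filter⁺ Q? (partitions-unique (n ∸ a))))
    (mk⇔ ⇒ ⇐)
    where
    ⇒ : ∀ {λs} → λs ∈ filter (a ∈?_) (filter P? (partitions n)) →
        λs ∈ map (insert a) (filter Q? (partitions (n ∸ a)))
    ⇒ {λs} λs∈ with ∈-filter⁻ (a ∈?_) {xs = filter P? (partitions n)} λs∈
    ... | λs∈′ , a∈λs with ∈-filter⁻ P? {xs = partitions n} λs∈′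
    ... | λs∈″ , Pλs with ∈-partitions⁻ {n} λs∈″
    ... | pos , desc , sum≡n =
      subst (_∈ map (insert a) (filter Q? (partitions (n ∸ a)))) insert≡
        (∈-map⁺ (insert a) (∈-filter⁺ Q?
          (∈-partitions⁺ (All-remove a pos , desc′ ,
            m+n≡o⇒n≡o∸m a (trans (sym (sum-insert a (remove a λs))) (trans (cong sum insert≡) sum≡n))))
          (to (P⇔Q desc′) (subst P (sym insert≡) Pλs))))
      where
      sorted : AllPairs _≥_ λs
      sorted = Linked⇒AllPairs ≥-trans desc
      insert≡ : insert a (remove a λs) ≡ λs
      insert≡ = insert-remove a sorted a∈λs
      desc′ : Descending (remove a λs)
      desc′ = AllPairs⇒Linked (AllPairs-remove a sorted)
      m+n≡o⇒n≡o∸m : ∀ m {n o} → m + n ≡ o → n ≡ o ∸ m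
      m+n≡o⇒n≡o∸m m {n} refl = sym (m+n∸m≡n m n)
    ⇐ : ∀ {λs} → λs ∈ map (insert a) (filter Q? (partitions (n ∸ a))) →
        λs ∈ filter (a ∈?_) (filter P? (partitions n))
    ⇐ λs∈ with ∈-map⁻ (insert a) λs∈
    ... | μ , μ∈ , refl with ∈-filter⁻ Q? {xs = partitions (n ∸ a)} μ∈
    ... | μ∈′ , Qμ with ∈-partitions⁻ {n ∸ a} μ∈′
    ... | pos , desc , sum≡ = ∈-filter⁺ (a ∈?_)
      (∈-filter⁺ P?
        (∈-partitions⁺ (All-insert⁺ 1≤a pos , insert-↗ a desc ,
          trans (sum-insert a μ) (trans (cong (a +_) sum≡) (m+[n∸m]≡n a≤n))))
        (from (P⇔Q desc) Qμ))
      (∈-insert a μ)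

  -- Only partitions that contain a contribute. Each is `insert a μ`, and the inserted copy adds 1
  -- to the multiplicity of a in μ.
  ∑-count-≤ : ∀ {n} → a ≤ n →
    ∑ (filter P? (partitions n)) (count a) ≡ # Q? (n ∸ a) + ∑ (filter Q? (partitions (n ∸ a))) (count a)
  ∑-count-≤ {n} a≤n = begin
    ∑ (filter P? (partitions n)) (count a)                     ≡⟨ ∑-support (a ∈?_) (count a) (filter P? (partitions n)) (λ _ → count-∉ a) ⟩
    ∑ (filter (a ∈?_) (filter P? (partitions n))) (count a)    ≡⟨ sum-↭ (map⁺-↭ (count a) (marked-↭ a≤n)) ⟩
    ∑ (map (insert a) μs) (count a)                            ≡⟨ ∑-map (count a) (insert a) μs ⟩
    ∑ μs (count a ∘ insert a)                                  ≡⟨ ∑-cong μs (λ {μ} _ → count-insert a μ) ⟩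
    ∑ μs (suc ∘ count a)                                       ≡⟨ ∑-suc (count a) μs ⟩
    length μs + ∑ μs (count a)                                 ∎
    where
    open ≡-Reasoning
    μs : List (List ℕ)
    μs = filter Q? (partitions (n ∸ a))

  module _ {P₀ : Pred (List ℕ) 0ℓ} (P₀? : Decidable P₀) (P×a∉⇔P₀ : ∀ {λs} → (P λs × a ∉ λs) ⇔ P₀ λs) where

    #-≤ : ∀ {n} → a ≤ n → # P? n ≡ # P₀? n + # Q? (n ∸ a)
    #-≤ {n} a≤n = trans
      (length-filter-split (λ λs → ¬? (a ∈? λs)) (a ∈?_) (filter P? (partitions n))
        (λ _ → id) (λ {λs} _ → decidable-stable (a ∈? λs)))
      (cong₂ _+_
        (trans (cong length (filter-filter (λ λs → ¬? (a ∈? λs)) P? (partitions n)))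
          (length-filter-cong _ P₀? (partitions n) (λ _ → P×a∉⇔P₀)))
        (trans (↭-length (marked-↭ a≤n)) (length-map (insert a) (filter Q? (partitions (n ∸ a))))))

    #-> : ∀ {n} → n < a → # P? n ≡ # P₀? n
    #-> {n} n<a = length-filter-cong P? P₀? (partitions n) (λ λs∈ →
      mk⇔ (λ Pλs → to P×a∉⇔P₀ (Pλs , a∉ λs∈)) (λ P₀λs → proj₁ (from P×a∉⇔P₀ P₀λs)))
      where
      a∉ : ∀ {λs} → λs ∈ partitions n → a ∉ λs
      a∉ λs∈ a∈ = <⇒≱ n<a (proj₂ (∈-range1⁻ (All.lookup (∈-partitions⇒∈-range1 {n} λs∈) a∈)))

∑-count-> : ∀ {P : Pred (List ℕ) 0ℓ} (P? : Decidable P) {a n} → n < a →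
  ∑ (filter P? (partitions n)) (count a) ≡ 0
∑-count-> P? {a} {n} n<a = ∑-zero (filter P? (partitions n)) (λ λs∈ → count-∉ a (λ a∈ →
  <⇒≱ n<a (proj₂ (∈-range1⁻ (All.lookup (∈-partitions⇒∈-range1 {n} (proj₁ (∈-filter⁻ P? {xs = partitions n} λs∈))) a∈)))))

-- Super-distinct partitions.

Far : ℕ → ℕ → Set
Far a p = p + 2 ≤ a ⊎ a + 2 ≤ p

far? : ∀ a p → Dec (Far a p)
far? a p = p + 2 ≤? a ⊎-dec a + 2 ≤? p

-- A gap of 2 between neighbours passes on to all pairs, and in a descending list only the first
-- alternative of `Far` can occur. Since `Far` is symmetric, the right-hand side is invariant under
-- permutations.
superDistinct⇔far : ∀ {λs} → Descending λs → SuperDistinct λs ⇔ AllPairs Far λs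
superDistinct⇔far desc = mk⇔
  (λ sd → AllPairs.map inj₁ (Linked⇒AllPairs (λ {x} {y} {z} y+2≤x z+2≤y → ≤-trans z+2≤y (≤-trans (m≤m+n y 2) y+2≤x)) sd))
  (λ far → AllPairs⇒Linked (AllPairs.zipWith (λ
    { (_ , inj₁ y+2≤x) → y+2≤x
    ; {x} {y} (y≤x , inj₂ x+2≤y) → contradiction (≤-trans x+2≤y y≤x) (m+1+n≰m x) })
    (Linked⇒AllPairs ≥-trans desc , far)))

-- In terms of `AllPairs Far` the inserted part may be moved to the front.
superDistinct-insert : ∀ a {μ} → Descending μ →
  SuperDistinct (insert a μ) ⇔ (SuperDistinct μ × All (Far a) μ)
superDistinct-insert a {μ} desc = mk⇔
  (λ sd → case far-resp (insert-↭ a μ) (to (superDistinct⇔far (insert-↗ a desc)) sd) of λ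
    { (far ∷ fars) → from (superDistinct⇔far desc) fars , far })
  (λ (sd , far) → from (superDistinct⇔far (insert-↗ a desc))
    (far-resp (↭-sym (insert-↭ a μ)) (far ∷ to (superDistinct⇔far desc) sd)))
  where
  open Function.Equivalence
  far-resp : ∀ {xs ys} → xs ↭ ys → AllPairs Far xs → AllPairs Far ys
  far-resp xs↭ys = Permₛ.AllPairs-resp-↭ (setoid ℕ) swap ((λ { refl → id }) , λ { refl → id }) (↭⇒↭ₛ xs↭ys)

Above : ℕ → List ℕ → Set
Above k λs = SuperDistinct λs × All (k <_) λs

above? : ∀ k → Decidable (Above k)
above? k λs = superDistinct? λs ×-dec all? (k <?_) λs

All-≤-suc : ∀ {k λs} → All (_≤ suc k) λs → suc k ∉ λs → All (_≤ k) λs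
All-≤-suc λs≤ ∉λs = All.tabulate (λ p∈ → ≤-pred (≤∧≢⇒< (All.lookup λs≤ p∈) λ { refl → ∉λs p∈ }))

-- A part p > k at distance at least 2 from k + 1 exceeds k + 2, because p + 2 ≤ k + 1 is
-- impossible.
above-insert : ∀ k {μ} → Descending μ → Above k (insert (suc k) μ) ⇔ Above (suc (suc k)) μ
above-insert k {μ} desc = mk⇔
  (λ (sd , k<) → let sd′ , far = to (superDistinct-insert (suc k) desc) sd in
    sd′ , All.zipWith (λ
      { (k<p , inj₁ p+2≤) → contradiction (≤-trans (≤-reflexive (+-comm 2 _)) p+2≤) (<⇒≱ (s≤s (m≤n⇒m≤1+n k<p)))
      ; (k<p , inj₂ k+3≤p) → ≤-trans (≤-reflexive (+-comm 2 (suc k))) k+3≤p })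
      (proj₂ (All-insert⁻ (suc k) μ k<) , far))
  (λ (sd , k+2<) →
    from (superDistinct-insert (suc k) desc) (sd , All.map (λ k+2<p → inj₂ (≤-trans (≤-reflexive (+-comm (suc k) 2)) k+2<p)) k+2<) ,
    All-insert⁺ ≤-refl (All.map (≤-trans (m≤n+m (suc k) 2)) k+2<))
  where open Function.Equivalence

above-suc : ∀ k {λs} → (Above k λs × suc k ∉ λs) ⇔ Above (suc k) λs
above-suc k = mk⇔
  (λ ((sd , k<) , ∉λs) → sd , All.tabulate (λ p∈ → ≤∧≢⇒< (All.lookup k< p∈) λ { refl → ∉λs p∈ }))
  (λ (sd , k+1<) → (sd , All.map <⇒≤ k+1<) , λ k+1∈ → <-irrefl refl (All.lookup k+1< k+1∈))

module Above-step k = Marking (above? k) (above? (2 + k)) (suc k) (s≤s z≤n) (above-insert k)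

#-above-large : ∀ {k n} → suc n ≤ k → # (above? k) (suc n) ≡ 0
#-above-large {k} {n} n<k = cong length (filter-none (above? k) {xs = partitions (suc n)} (All.tabulate (λ {λs} → none λs)))
  where
  none : ∀ λs → λs ∈ partitions (suc n) → ¬ Above k λs
  none λs λs∈ (_ , k<) with λs | ∈-partitions⁻ {suc n} λs∈
  ... | p ∷ ps | _ , _ , sum≡ = <⇒≱ (≤-trans (s≤s n<k) (All.head k<)) (≤-trans (m≤m+n p (sum ps)) (≤-reflexive sum≡))

-- Partitions into bounded parts that are ±1 mod 5.

PM≤ : ℕ → List ℕ → Set
PM≤ m = All (λ p → PM1mod5 p × p ≤ m)

pm≤? : ∀ m → Decidable (PM≤ m)
pm≤? m = all? (λ p → pm1mod5? p ×-dec p ≤? m)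

pm≤-insert : ∀ {m} → PM1mod5 m → ∀ {μ} → Descending μ → PM≤ m (insert m μ) ⇔ PM≤ m μ
pm≤-insert {m} pm {μ} _ = mk⇔ (proj₂ ∘ All-insert⁻ m μ) (All-insert⁺ (pm , ≤-refl))

pm≤-suc : ∀ m {λs} → (PM≤ (suc m) λs × suc m ∉ λs) ⇔ PM≤ m λs
pm≤-suc m = mk⇔
  (λ (pms , ∉λs) → All.zip (All.map proj₁ pms , All-≤-suc (All.map proj₂ pms) ∉λs))
  (λ pms → All.map (λ (pm , p≤m) → pm , m≤n⇒m≤1+n p≤m) pms , λ m+1∈ → <-irrefl refl (proj₂ (All.lookup pms m+1∈)))

#-pm≤-skip : ∀ m n → ¬ PM1mod5 (suc m) → # (pm≤? (suc m)) n ≡ # (pm≤? m) n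
#-pm≤-skip m n ¬pm = length-filter-cong (pm≤? (suc m)) (pm≤? m) (partitions n) (λ _ → mk⇔
  (λ pms → to (pm≤-suc m) (pms , λ m+1∈ → ¬pm (proj₁ (All.lookup pms m+1∈))))
  (λ pms → proj₁ (from (pm≤-suc m) pms)))
  where open Function.Equivalence

module PM≤-step m (pm : PM1mod5 (suc m)) = Marking (pm≤? (suc m)) (pm≤? (suc m)) (suc m) (s≤s z≤n) (pm≤-insert pm)

#-pm≤0 : ∀ n → # (pm≤? 0) (suc n) ≡ 0
#-pm≤0 n = cong length (filter-none (pm≤? 0) {xs = partitions (suc n)} (All.tabulate (λ {λs} → none λs)))
  where
  none : ∀ λs → λs ∈ partitions (suc n) → ¬ PM≤ 0 λs
  none λs λs∈ pms with λs | pms | ∈-partitions⁻ {suc n} λs∈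
  ... | p ∷ ps | (_ , p≤0) ∷ _ | (1≤p ∷ _) , _ = <⇒≱ 1≤p p≤0

-- Generating functions and the identity for partition counts.

module GeneratingFunctions (N : ℕ) where

  open Truncated (suc N)
  open CommutativeRing ring using (0#; 1#) renaming
    ( _≈_ to _≋_; _+_ to _⊞_; _*_ to _⊠_; _-_ to _⊟_; refl to ≋-refl; sym to ≋-sym; trans to ≋-trans
    ; +-cong to ⊞-cong; +-congʳ to ⊞-congʳ; +-congˡ to ⊞-congˡ; *-congˡ to ⊠-congˡ; setoid to ≋-setoid
    ; +-assoc to ⊞-assoc; -‿inverseʳ to ⊟-inverseʳ; +-identityʳ to ⊞-identityʳ
    ; *-identityˡ to ⊠-identityˡ; distribʳ to ⊠-distribʳ )
  open Algebra.Properties.CommutativeSemiring.Exp (CommutativeRing.commutativeSemiring ring) using (_^_)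

  -- Multiplication by `X ^ k` shifts the coefficients by k: below k the last summand is 0, from k
  -- on it is `h (n ∸ k)`.
  recursion⇒series : ∀ (f g h : ℕ → ℕ) k → (∀ {n} → k ≤ n → f n ≡ g n + h (n ∸ k)) → (∀ {n} → n < k → f n ≡ g n) →
    (ℤ.+_ ∘ f) ≋ (ℤ.+_ ∘ g) ⊞ X ^ k ⊠ (ℤ.+_ ∘ h)
  recursion⇒series f g h k ≤-step <-step n _ = trans (go (k ≤? n)) (cong (λ z → ℤ.+ g n ℤ.+ z) (sym (X^-⊛ k (ℤ.+_ ∘ h) n)))
    where
    go : Dec (k ≤ n) → ℤ.+ f n ≡ ℤ.+ g n ℤ.+ shift k (ℤ.+_ ∘ h) n
    go (yes k≤n) = trans (cong ℤ.+_ (≤-step k≤n)) (cong (λ z → ℤ.+ g n ℤ.+ z) (sym (shift-≤ k (ℤ.+_ ∘ h) k≤n)))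
    go (no k≰n)  = trans (cong ℤ.+_ (<-step (≰⇒> k≰n)))
      (trans (sym (ℤ.+-identityʳ (ℤ.+ g n))) (cong (λ z → ℤ.+ g n ℤ.+ z) (sym (shift-< k (ℤ.+_ ∘ h) (≰⇒> k≰n)))))

  above-series pm-series : ℕ → Series
  above-series k n = ℤ.+ # (above? k) n
  pm-series m n = ℤ.+ # (pm≤? m) n

  above-large : ∀ k → suc N ≤ k → above-series k ≋ 1#
  above-large k N<k zero    _   = refl
  above-large k N<k (suc n) n<N = cong ℤ.+_ (#-above-large (≤-trans (<⇒≤ n<N) N<k))

  -- The two summands correspond to the absence and the presence of the part k + 1.
  above-step : ∀ k → above-series k ≋ above-series (suc k) ⊞ X ^ suc k ⊠ above-series (suc (suc k))
  above-step k = recursion⇒series _ _ _ (suc k) (#-≤ (above? (suc k)) (above-suc k)) (#-> (above? (suc k)) (above-suc k))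
    where open Above-step k

  pm-0 : pm-series 0 ≋ 1#
  pm-0 zero    _ = refl
  pm-0 (suc n) _ = cong ℤ.+_ (#-pm≤0 n)

  pm-skip : ∀ m → ¬ PM1mod5 (suc m) → pm-series (suc m) ≋ pm-series m
  pm-skip m ¬pm n _ = cong ℤ.+_ (#-pm≤-skip m n ¬pm)

  -- Removing one copy of m + 1, which may occur repeatedly, gives f = g + x^{m+1} f.
  pm-step : ∀ m → PM1mod5 (suc m) → (1# ⊟ X ^ suc m) ⊠ pm-series (suc m) ≋ pm-series m
  pm-step m pm = begin
    (1# ⊟ y) ⊠ f             ≈⟨ ⊠-distribʳ f 1# (⊖ y) ⟩
    1# ⊠ f ⊞ (⊖ y) ⊠ f       ≈⟨ ⊞-cong (⊠-identityˡ f) (≋-sym (-‿distribˡ-* y f)) ⟩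
    f ⊟ y ⊠ f                ≈⟨ ⊞-congʳ (recursion⇒series _ _ _ (suc m) (#-≤ (pm≤? m) (pm≤-suc m)) (#-> (pm≤? m) (pm≤-suc m))) ⟩
    (g ⊞ y ⊠ f) ⊟ y ⊠ f      ≈⟨ ⊞-assoc g (y ⊠ f) _ ⟩
    g ⊞ (y ⊠ f ⊟ y ⊠ f)      ≈⟨ ⊞-congˡ {g} (⊟-inverseʳ (y ⊠ f)) ⟩
    g ⊞ 0#                   ≈⟨ ⊞-identityʳ g ⟩
    g                        ∎
    where
    open PM≤-step m pm
    open import Relation.Binary.Reasoning.Setoid ≋-setoid
    open Algebra.Properties.Ring (CommutativeRing.ring ring) using (-‿distribˡ-*)
    y f g : Series
    y = X ^ suc m
    f = pm-series (suc m)
    g = pm-series m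

  -- Among 5n + 1, ..., 5n + 5 only 5n + 1 and 5n + 4 are admissible parts; the other three are
  -- skipped.
  pm-period : ∀ n → (1# ⊟ X ^ suc (n * 5)) ⊠ ((1# ⊟ X ^ (4 + n * 5)) ⊠ pm-series (suc n * 5)) ≋ pm-series (n * 5)
  pm-period n = ≋-trans
    (⊠-congˡ (≋-trans (⊠-congˡ (pm-skip (4 + n * 5) (¬pm 5 refl λ { (inj₁ ()) ; (inj₂ ()) })))
      (≋-trans (pm-step (3 + n * 5) (inj₂ (residue 4)))
        (≋-trans (pm-skip (2 + n * 5) (¬pm 3 refl λ { (inj₁ ()) ; (inj₂ ()) }))
          (pm-skip (1 + n * 5) (¬pm 2 refl λ { (inj₁ ()) ; (inj₂ ()) }))))))
    (pm-step (n * 5) (inj₁ (residue 1)))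
    where
    residue : ∀ i → (i + n * 5) % 5 ≡ i % 5
    residue i = [m+kn]%n≡m%n i n 5
    ¬pm : ∀ i {j} → i % 5 ≡ j → ¬ (j ≡ 1 ⊎ j ≡ 4) → ¬ PM1mod5 (i + n * 5)
    ¬pm i refl ¬j pm = ¬j (subst (λ r → r ≡ 1 ⊎ r ≡ 4) (residue i) pm)

  rogers-ramanujan-≤ : above-series 0 ≋ pm-series (suc N * 5)
  rogers-ramanujan-≤ = RogersRamanujan.rogers-ramanujan ring constants N X X^-nilpotent
    above-series (λ n → pm-series (n * 5)) above-large above-step pm-0 pm-period

allPM? : Decidable (All PM1mod5)
allPM? = all? pm1mod5?

-- The coefficient of xⁿ is read off modulo x^{n+1}. Every part of a partition of n is positive and
-- at most 5(n + 1), so the two series count the right partitions there.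
first-rogers-ramanujan : ∀ n → # allPM? n ≡ # superDistinct? n
first-rogers-ramanujan n = begin
  # allPM? n               ≡⟨ length-filter-cong allPM? (pm≤? (suc n * 5)) (partitions n) (λ λs∈ →
                                mk⇔ (λ pms → All.zip (pms , bounded λs∈)) (All.map proj₁)) ⟩
  # (pm≤? (suc n * 5)) n   ≡⟨ ℤ.+-injective (rogers-ramanujan-≤ n ≤-refl) ⟨
  # (above? 0) n           ≡⟨ length-filter-cong (above? 0) superDistinct? (partitions n) (λ λs∈ →
                                mk⇔ proj₁ (λ sd → sd , proj₁ (∈-partitions⁻ {n} λs∈))) ⟩
  # superDistinct? n       ∎
  where
  open ≡-Reasoning
  open GeneratingFunctions n
  bounded : ∀ {λs} → λs ∈ partitions n → All (_≤ suc n * 5) λs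
  bounded λs∈ = All.map (λ p∈ → ≤-trans (proj₂ (∈-range1⁻ p∈)) (≤-trans (n≤1+n n) (m≤m*n (suc n) 5)))
    (∈-partitions⇒∈-range1 {n} λs∈)

-- Counting parts by their multiplicities.

∑-length : ∀ {P : Pred (List ℕ) 0ℓ} (P? : Decidable P) n →
  ∑ (filter P? (partitions n)) length ≡ ∑ (range1 n) (λ a → ∑ (filter P? (partitions n)) (count a))
∑-length P? n = trans
  (∑-cong (filter P? (partitions n)) (λ λs∈ →
    sym (∑-count (∈-partitions⇒∈-range1 {n} (proj₁ (∈-filter⁻ P? {xs = partitions n} λs∈))))))
  (∑-swap (λ λs a → count a λs) (filter P? (partitions n)) (range1 n))

∑ᵇ-[_*b≤_] : ℕ → ℕ → List ℕ → (ℕ → ℕ) → ℕ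
∑ᵇ-[ a *b≤ n ] bs f = ∑ bs (λ b → if does (a * b ≤? n) then f b else 0)

-- Removing one copy of a yields the term b = 1 and lowers every other b by one. The induction is on
-- M, since n drops by a ≥ 1 each time; terms with ab > n are 0, so the range of b may exceed n.
∑-count-multiples : ∀ {a} → 1 ≤ a → PM1mod5 a → ∀ M {n} → n ≤ M →
  ∑ (filter allPM? (partitions n)) (count a) ≡ ∑ᵇ-[ a *b≤ n ] (range1 M) (λ b → # allPM? (n ∸ a * b))
∑-count-multiples 1≤a pm zero {zero} _ = ∑-count-> allPM? 1≤a
∑-count-multiples {a} 1≤a pm (suc M) {n} n≤ with a ≤? n
... | no a≰n = trans (∑-count-> allPM? (≰⇒> a≰n)) (sym (∑-zero (range1 (suc M)) (λ {b} b∈ →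
    cong (λ t → if t then # allPM? (n ∸ a * b) else 0) (dec-false (a * b ≤? n) (λ ab≤n →
      a≰n (≤-trans (m≤m*n a b {{>-nonZero (proj₁ (∈-range1⁻ b∈))}}) ab≤n))))))
... | yes a≤n = begin
  ∑ (filter allPM? (partitions n)) (count a)
    ≡⟨ Marking.∑-count-≤ allPM? allPM? a 1≤a (λ {μ} _ → mk⇔ (proj₂ ∘ All-insert⁻ a μ) (All-insert⁺ pm)) a≤n ⟩
  # allPM? (n ∸ a) + ∑ (filter allPM? (partitions (n ∸ a))) (count a)
    ≡⟨ cong₂ _+_ (sym first) (∑-count-multiples 1≤a pm M n∸a≤M) ⟩
  term 1 + ∑ᵇ-[ a *b≤ n ∸ a ] (range1 M) (λ b → # allPM? (n ∸ a ∸ a * b))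
    ≡⟨ cong (term 1 +_) (∑-cong (range1 M) (λ {b} _ → sym (shifted b))) ⟩
  term 1 + ∑ (range1 M) (term ∘ suc)
    ≡⟨ cong (term 1 +_) (∑-map term suc (range1 M)) ⟨
  ∑ (1 ∷ map suc (range1 M)) term
    ≡⟨ cong (λ bs → ∑ bs term) (range1-suc M) ⟨
  ∑ (range1 (suc M)) term ∎
  where
  open ≡-Reasoning
  term : ℕ → ℕ
  term b = if does (a * b ≤? n) then # allPM? (n ∸ a * b) else 0
  n∸a≤M : n ∸ a ≤ M
  n∸a≤M = ∸-mono n≤ 1≤a
  first : term 1 ≡ # allPM? (n ∸ a)
  first rewrite *-identityʳ a | dec-true (a ≤? n) a≤n = refl
  shifted : ∀ b → term (suc b) ≡ (if does (a * b ≤? n ∸ a) then # allPM? (n ∸ a ∸ a * b) else 0)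
  shifted b = cong₂ (λ t m → if t then # allPM? m else 0)
    (does-⇔ (mk⇔
        (λ le → m+n≤o⇒n≤o∸m a (≤-trans (≤-reflexive (sym (*-suc a b))) le))
        (λ le → ≤-trans (≤-reflexive (*-suc a b)) (≤-trans (+-monoʳ-≤ a le) (≤-reflexive (m+[n∸m]≡n a≤n)))))
      (a * suc b ≤? n) (a * b ≤? n ∸ a))
    (trans (cong (n ∸_) (*-suc a b)) (sym (∸-+-assoc n a (a * b))))
    where
    m+n≤o⇒n≤o∸m : ∀ m {n o} → m + n ≤ o → n ≤ o ∸ m
    m+n≤o⇒n≤o∸m m {n} le = m+n≤o⇒m≤o∸n n (≤-trans (≤-reflexive (+-comm n m)) le)

-- Marked parts and pairs.

#SDFar : ℕ → ℕ → ℕ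
#SDFar b = # (λ λs → superDistinct? λs ×-dec all? (far? b) λs)

¬far-self : ∀ {b p} → Far b p → b ≢ p
¬far-self {b} (inj₁ le) refl = m+1+n≰m b le
¬far-self {b} (inj₂ le) refl = m+1+n≰m b le

-- By `superDistinct-insert`, `#SDFar b` counts the partitions to which b can be added. They do not
-- contain b, so the second sum in `Marking.∑-count-≤` vanishes.
B-marked : ∀ n → B n ≡ ∑ (range1 n) (λ b → #SDFar b (n ∸ b))
B-marked n = trans (∑-length superDistinct? n) (∑-cong (range1 n) (λ {b} b∈ →
  let 1≤b , b≤n = ∈-range1⁻ b∈ in
  trans (Marking.∑-count-≤ superDistinct? (λ λs → superDistinct? λs ×-dec all? (far? b) λs) b 1≤b (superDistinct-insert b) b≤n)
    (trans (cong (#SDFar b (n ∸ b) +_) (∑-zero (filter _ (partitions (n ∸ b))) (λ μ∈ →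
        count-∉ b (λ b∈μ → ¬far-self (All.lookup (proj₂ (proj₂ (∈-filter⁻ _ {xs = partitions (n ∸ b)} μ∈))) b∈μ) refl))))
      (+-identityʳ _))))

Near : ℕ → ℕ → Set
Near b p = p ≡ b ∸ 1 ⊎ (p ≡ b ⊎ p ≡ suc b)

-- Stated for `suc b`, where `b ∸ 1` in `Near` is a true predecessor.
far⇒¬near : ∀ {b p} → Far (suc b) p → ¬ Near (suc b) p
far⇒¬near {b} (inj₁ le) (inj₁ refl)        = 1+n≰n (≤-trans (≤-reflexive (+-comm 2 b)) le)
far⇒¬near {b} (inj₂ le) (inj₁ refl)        = 1+n≰n (≤-trans (m≤m+n (suc b) 2) le)
far⇒¬near     far       (inj₂ (inj₁ refl)) = ¬far-self far refl
far⇒¬near {b} (inj₁ le) (inj₂ (inj₂ refl)) = 1+n≰n (≤-trans (m≤m+n (suc (suc b)) 2) le)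
far⇒¬near {b} (inj₂ le) (inj₂ (inj₂ refl)) = 1+n≰n (≤-trans (≤-reflexive (+-comm 2 (suc b))) le)

¬near⇒far : ∀ {b p} → ¬ Near (suc b) p → Far (suc b) p
¬near⇒far {b} {p} ¬near with <-cmp p (suc b)
... | tri≈ _ p≡ _ = contradiction (inj₂ (inj₁ p≡)) ¬near
... | tri< p< _ _ = inj₁ (≤-trans (≤-reflexive (+-comm p 2)) (s≤s (≤∧≢⇒< (≤-pred p<) (λ p≡ → ¬near (inj₁ p≡)))))
... | tri> _ _ p> = inj₂ (≤-trans (≤-reflexive (+-comm (suc b) 2)) (≤∧≢⇒< p> (λ ≡p → ¬near (inj₂ (inj₂ (sym ≡p))))))

#pairs : ℕ → ℕ → ℕ → ℕ
#pairs a b m = length (filter (pairCond? a b) (filter superDistinct? (partitions m)))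

C-pairs : ∀ n → C n ≡ ∑ (range1 n) (λ a → ∑ᵇ-[ a *b≤ n ] (range1 n) (λ b → #pairs a b (n ∸ a * b)))
C-pairs n = trans (length-concatMap _ (range1 n)) (∑-cong (range1 n) (λ {a} _ →
  trans (length-concatMap _ (filter (λ b → a * b ≤? n) (range1 n)))
    (trans (∑-cong (filter (λ b → a * b ≤? n) (range1 n)) (λ {b} _ →
        length-filter-map (λ t → pairCond? (proj₁ t) (proj₁ (proj₂ t)) (proj₂ (proj₂ t))) (λ λs → (a , b , λs))
          (filter superDistinct? (partitions (n ∸ a * b)))))
      (∑-filter (λ b → a * b ≤? n) (λ b → #pairs a b (n ∸ a * b)) (range1 n)))))

#pairs-¬pm : ∀ {a} → ¬ PM1mod5 a → ∀ b m → #pairs a b m ≡ 0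
#pairs-¬pm {a} ¬pm b m = cong length (filter-none (pairCond? a b) {xs = filter superDistinct? (partitions m)}
  (All.universal (λ _ → ¬pm ∘ proj₁) _))

-- For these a the pair condition always holds, so all super-distinct partitions of m are counted;
-- Rogers-Ramanujan converts their number.
#pairs-≢1 : ∀ {a} → PM1mod5 a → a ≢ 1 → ∀ b m → #pairs a b m ≡ # allPM? m
#pairs-≢1 {a} pm a≢1 b m = trans
  (cong length (filter-all (pairCond? a b) {xs = filter superDistinct? (partitions m)}
    (All.universal (λ _ → pm , λ a≡1 → contradiction a≡1 a≢1) _)))
  (sym (first-rogers-ramanujan m))

-- After Rogers-Ramanujan, a super-distinct partition either has a part near b, and then it belongs
-- to a pair, or has all its parts far from b.
#pairs-1 : ∀ {b} → 1 ≤ b → ∀ m → # allPM? m ≡ #pairs 1 b m + #SDFar b m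
#pairs-1 {suc b} _ m = trans (first-rogers-ramanujan m) (trans
  (length-filter-split (pairCond? 1 (suc b)) (all? (far? (suc b))) (filter superDistinct? (partitions m))
    (λ _ (_ , near) far → All.lookupWith far⇒¬near far (near refl))
    (λ {λs} _ ¬cond → All.map ¬near⇒far (All.¬Any⇒All¬ λs (λ near → ¬cond (inj₁ refl , λ _ → near)))))
  (cong (λ λss → #pairs 1 (suc b) m + length λss) (filter-filter (all? (far? (suc b))) superDistinct? (partitions m))))

∑-count-pairs-1 : ∀ n → ∑ (filter allPM? (partitions n)) (count 1) ≡
  ∑ᵇ-[ 1 *b≤ n ] (range1 n) (λ b → #pairs 1 b (n ∸ 1 * b)) + B n
∑-count-pairs-1 n = begin
  ∑ (filter allPM? (partitions n)) (count 1)
    ≡⟨ ∑-count-multiples ≤-refl (inj₁ refl) n ≤-refl ⟩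
  ∑ᵇ-[ 1 *b≤ n ] (range1 n) (λ b → # allPM? (n ∸ 1 * b))
    ≡⟨ ∑-cong (range1 n) split ⟩
  ∑ (range1 n) (λ b → pairs-term b + #SDFar b (n ∸ b))
    ≡⟨ ∑-+ pairs-term (λ b → #SDFar b (n ∸ b)) (range1 n) ⟩
  ∑ (range1 n) pairs-term + ∑ (range1 n) (λ b → #SDFar b (n ∸ b))
    ≡⟨ cong (∑ (range1 n) pairs-term +_) (B-marked n) ⟨
  ∑ (range1 n) pairs-term + B n ∎
  where
  open ≡-Reasoning
  pairs-term : ℕ → ℕ
  pairs-term b = if does (1 * b ≤? n) then #pairs 1 b (n ∸ 1 * b) else 0
  split : ∀ {b} → b ∈ range1 n →
    (if does (1 * b ≤? n) then # allPM? (n ∸ 1 * b) else 0) ≡ pairs-term b + #SDFar b (n ∸ b)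
  split {b} b∈ rewrite *-identityˡ b | dec-true (b ≤? n) (proj₂ (∈-range1⁻ b∈)) =
    #pairs-1 (proj₁ (∈-range1⁻ b∈)) (n ∸ b)

-- Only a = 1 leaves a remainder, namely the marked super-distinct partitions counted by `B n`. If a
-- is not ±1 mod 5, both sides are 0.
∑-count-pairs : ∀ n {a} → a ∈ range1 n →
  ∑ (filter allPM? (partitions n)) (count a) ≡
    ∑ᵇ-[ a *b≤ n ] (range1 n) (λ b → #pairs a b (n ∸ a * b)) + (if does (a ≟ 1) then B n else 0)
∑-count-pairs n {a} a∈ = by-cases a∈ (pm1mod5? a) (a ≟ 1)
  where
  if-zero : ∀ t {k} → k ≡ 0 → (if t then k else 0) ≡ 0
  if-zero true  eq = eq
  if-zero false _  = refl
  no-bonus : ∀ {a} → a ≢ 1 → ∀ k → k + (if does (a ≟ 1) then B n else 0) ≡ k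
  no-bonus {a} a≢1 k = trans (cong (λ t → k + (if t then B n else 0)) (dec-false (a ≟ 1) a≢1)) (+-identityʳ k)
  by-cases : ∀ {a} → a ∈ range1 n → Dec (PM1mod5 a) → Dec (a ≡ 1) →
    ∑ (filter allPM? (partitions n)) (count a) ≡
      ∑ᵇ-[ a *b≤ n ] (range1 n) (λ b → #pairs a b (n ∸ a * b)) + (if does (a ≟ 1) then B n else 0)
  by-cases _ _ (yes refl) = ∑-count-pairs-1 n
  by-cases {a} a∈ (no ¬pm) (no a≢1) = trans
    (∑-zero (filter allPM? (partitions n)) (λ λs∈ → count-∉ a (λ a∈λs →
      ¬pm (All.lookup (proj₂ (∈-filter⁻ allPM? {xs = partitions n} λs∈)) a∈λs))))
    (sym (trans (no-bonus a≢1 _) (∑-zero (range1 n) (λ {b} _ → if-zero (does (a * b ≤? n)) (#pairs-¬pm ¬pm b (n ∸ a * b))))))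
  by-cases {a} a∈ (yes pm) (no a≢1) = trans
    (∑-count-multiples (proj₁ (∈-range1⁻ a∈)) pm n ≤-refl)
    (trans (∑-cong (range1 n) (λ {b} _ → cong (λ k → if does (a * b ≤? n) then k else 0) (sym (#pairs-≢1 pm a≢1 b (n ∸ a * b)))))
      (sym (no-bonus a≢1 _)))

∑-only-1 : ∀ n k → ∑ (range1 (suc n)) (λ a → if does (a ≟ 1) then k else 0) ≡ k
∑-only-1 n k = begin
  ∑ (range1 (suc n)) f                 ≡⟨ cong (λ as → ∑ as f) (range1-suc n) ⟩
  k + ∑ (map suc (range1 n)) f         ≡⟨ cong (k +_) (∑-map f suc (range1 n)) ⟩
  k + ∑ (range1 n) (f ∘ suc)           ≡⟨ cong (k +_) (∑-zero (range1 n) (λ a∈ → f-suc (proj₁ (∈-range1⁻ a∈)))) ⟩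
  k + 0                                ≡⟨ +-identityʳ k ⟩
  k                                    ∎
  where
  open ≡-Reasoning
  f : ℕ → ℕ
  f a = if does (a ≟ 1) then k else 0
  f-suc : ∀ {a} → 1 ≤ a → f (suc a) ≡ 0
  f-suc (s≤s _) = refl

theorem1 : ∀ (n : ℕ) → A n ≡ B n + C n
-- `range1 0` is empty and lacks a = 1, the index that carries `B n`; this case is settled by
-- evaluation.
theorem1 zero    = refl
theorem1 n@(suc m) = begin
  A n
    ≡⟨ ∑-length allPM? n ⟩
  ∑ (range1 n) (λ a → ∑ (filter allPM? (partitions n)) (count a))
    ≡⟨ ∑-cong (range1 n) (∑-count-pairs n) ⟩
  ∑ (range1 n) (λ a → c a + (if does (a ≟ 1) then B n else 0))
    ≡⟨ ∑-+ c _ (range1 n) ⟩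
  ∑ (range1 n) c + ∑ (range1 n) (λ a → if does (a ≟ 1) then B n else 0)
    ≡⟨ cong₂ _+_ (sym (C-pairs n)) (∑-only-1 m (B n)) ⟩
  C n + B n
    ≡⟨ +-comm (C n) (B n) ⟩
  B n + C n ∎
  where
  open ≡-Reasoning
  c : ℕ → ℕ
  c a = ∑ᵇ-[ a *b≤ n ] (range1 n) (λ b → #pairs a b (n ∸ a * b))
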